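{- For all positive integers $t,\delta$ there exists a positive integer $j=j(t,\delta)$ with the following property (one may take $j(t,\delta)=\binom{\delta}{2}R(t,3)$). Let $G$ be a (theta, prism)-free graph with no clique of cardinality $t$, let $a\in V(G)$, let $T$ be a smooth tree of maximum degree $\delta$, and let $\zeta$ be a rich $(T,a)$-strip-structure in $G$. Then for every vertex $v\in V(T)$ we have $|\mathcal{J}_{\zeta,v}|<j$.
   Context: Graphs finite simple; "path" = induced path. $R(p,q)$ denotes the Ramsey number: least $n$ such that every graph on at least $n$ vertices has a clique of size $p$ or a stable set of size $q$. Theta: two non-adjacent vertices joined by three internally disjoint paths of length $\ge2$ with pairwise anticomplete interiors. Prism: two disjoint triangles $\{a_1,a_2,a_3\},\{b_1,b_2,b_3\}$, disjoint paths $P_i$ from $a_i$ to $b_i$, with $a_ia_j,b_ib_j$ the only edges between $P_i,P_j$. Pyramid: apex $a$, base triangle $\{b_1,b_2,b_3\}$, paths $P_i$ from $a$ to $b_i$ of length $\ge1$, otherwise disjoint, $b_ib_j$ the only edge between $P_i\setminus\{a\}$, $P_j\setminus\{a\}$, at most one $P_i$ of length one. A vertex $p\notin\Sigma$ is a jewel for pyramid $\Sigma$ at $b_i$ if $p$ is anticomplete to $P_i$ and $N_{P_j}(p)=N_{P_j}[b_j]$ for $j\ne i$. A tree is smooth if it has $\ge3$ vertices and each vertex is a leaf or has degree $>2$. For $\zeta: V(T)\cup E(T)\cup(E(T)\times V(T))\to 2^{V(G)\setminus\{a\}}$, $S\subseteq V(T)$: $\zeta(S)=\bigcup_{v\in S}\zeta(v)\cup\bigcup_{e\in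 E(T[S])}\zeta(e)$, $\zeta(T)=\zeta(V(T))$, $\zeta^+(T)=\zeta(T)\cup\{a\}$, $B(v)=\bigcup_{e\ni v}\zeta(e,v)$, $\zeta^\circ(e)=\zeta(e)\setminus(\zeta(e,u)\cup\zeta(e,v))$ for $e=uv$. $\zeta$ is a $(T,a)$-strip-structure if (S1) the sets $\zeta(o)$, $o\in V(T)\cup E(T)$, are pairwise disjoint; (S2) $\zeta(l)=\emptyset$ for leaves; (S3) $\zeta(e,v)\subseteq\zeta(e)$, nonempty iff $e$ incident with $v$; (S4) for distinct $e,f$ and every $v$, $\zeta(e,v)$ complete to $\zeta(f,v)$, no other edges between $\zeta(e),\zeta(f)$; (S5) for $e=uv$, every $x\in\zeta(e)$ has a path in $G[\zeta(e)]$ to $\zeta(e,u)$ with interior in $\zeta^\circ(e)$, and likewise to $\zeta(e,v)$; (S6) $\zeta(v)$ anticomplete to $\zeta(e)\setminus\zeta(e,v)$; (S7) every component of $G[\zeta(v)]$ has a neighbor in $B(v)$; (S8) for each leaf $l$ with edge $e$, $a$ complete to $\zeta(e,l)$, no other neighbors of $a$ in $\zeta(T)$. A $\zeta(e)$-rung ($e=uv$) is a path $P$ in $G[\zeta(e)]$ with either $|P|=1$, $P\subseteq\zeta(e,u)\cap\zeta(e,v)$, or an end in $\zeta(e,u)\setminus\zeta(e,v)$, an end in $\zeta(e,v)\setminus\zeta(e,u)$, interior in $\zeta^\circ(e)$; long if $|P|\ge2$. $\zeta$ is rich if $a$ is trapped in $\zeta^+(T)$ (all vertices at distance $\le2$ from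 $a$ lie in $\zeta^+(T)$, every neighbor of $a$ has degree two in $G[\zeta^+(T)]$) and $|\zeta(e,l)|=1$ for each leaf $l$ with edge $e$. A $\zeta$-pyramid at claw $(v,e_1,e_2,e_3)$ (distinct edges at $v$) is a pyramid with apex $a$, base $b_1b_2b_3$, paths $P_i$ with $b_i\in\zeta(e_i,v)$ and a leaf $l_i$ in the component of $T-e_i$ not containing $v$ such that, for $\Lambda_i$ the $T$-path from $v$ to $l_i$, $P_i=\Gamma_i\cup\{a\}$, $\Gamma_i$ a path in $\bigcup_{e\in E(\Lambda_i)}\zeta(e)$, $\Gamma_i\cap\zeta(e_i)$ a long $\zeta(e_i)$-rung and $\Gamma_i\cap\zeta(e)$ a $\zeta(e)$-rung for other $e\in E(\Lambda_i)$. A vertex $p\in V(G)\setminus\zeta^+(T)$ is a jewel for $\zeta$ at seagull $(v,e_1,e_2)$ (distinct edges at $v$) if for some $e_3\notin\{e_1,e_2\}$ at $v$ there is a $\zeta$-pyramid at $(v,e_1,e_2,e_3)$ with $b_i\in\zeta(e_i,v)$ such that $p$ is a jewel for it at $b_3$. $\mathcal{J}_{\zeta,v}$ = set of jewels for $\zeta$ at seagulls at $v$. -}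

module Defs where

open import Data.Nat using (ℕ; zero; suc; _+_; _*_; _≤_; _<_)
open import Data.Nat.Combinatorics using (_C_)
open import Data.Fin using (Fin; zero; suc; toℕ; fromℕ; inject₁)
open import Data.Bool using (Bool; true; false; if_then_else_)
open import Data.Product using (Σ; ∃; ∃-syntax; _×_; _,_)
open import Data.Sum using (_⊎_)
open import Data.Empty using (⊥)
open import Relation.Nullary using (¬_)
open import Relation.Binary.PropositionalEquality using (_≡_; _≢_)

Iff : Set → Set → Set
Iff A B = (A → B) × (B → A)

count : ∀ {m} → (Fin m → Bool) → ℕ
count {zero} f = 0
count {suc m} f = (if f zero then 1 else 0) + count (λ i → f (suc i))

tri3 : ∀ {A : Set} → A → A → A → Fin 3 → A
tri3 x y z zero = x
tri3 x y z (suc zero) = y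
tri3 x y z (suc (suc zero)) = z

record Graph : Set where
  field
    n      : ℕ
    adj    : Fin n → Fin n → Bool
    sym    : ∀ x y → adj x y ≡ adj y x
    irrefl : ∀ x → adj x x ≡ false

open Graph public

V : Graph → Set
V G = Fin (n G)

E : (G : Graph) → V G → V G → Set
E G x y = adj G x y ≡ true

deg : (G : Graph) → V G → ℕ
deg G v = count (adj G v)

Leaf : (G : Graph) → V G → Set
Leaf G v = deg G v ≡ 1

record Path (G : Graph) : Set where
  field
    len    : ℕ
    vx     : Fin (suc len) → V G
    inj    : ∀ i j → vx i ≡ vx j → i ≡ j
    adjIff : ∀ i j → Iff (E G (vx i) (vx j))
                         (toℕ i ≡ suc (toℕ j) ⊎ toℕ j ≡ suc (toℕ i))

open Path public

start : ∀ {G} → Path G → V G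
start P = vx P zero

finish : ∀ {G} → Path G → V G
finish P = vx P (fromℕ (len P))

onPath : ∀ {G} → Path G → V G → Set
onPath P x = ∃[ i ] vx P i ≡ x

interior : ∀ {G} → Path G → V G → Set
interior P x = ∃[ i ] (0 < toℕ i × toℕ i < len P × vx P i ≡ x)

HasClique : (G : Graph) → ℕ → Set
HasClique G p = Σ (Fin p → V G) λ f →
  (∀ i j → f i ≡ f j → i ≡ j) × (∀ i j → i ≢ j → E G (f i) (f j))

HasStable : (G : Graph) → ℕ → Set
HasStable G q = Σ (Fin q → V G) λ f →
  (∀ i j → f i ≡ f j → i ≡ j) × (∀ i j → ¬ E G (f i) (f j))

RamseyProp : ℕ → ℕ → ℕ → Set
RamseyProp p q r = ∀ (H : Graph) → r ≤ n H → HasClique H p ⊎ HasStable H q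

IsRamsey : ℕ → ℕ → ℕ → Set
IsRamsey p q r = RamseyProp p q r × (∀ r' → RamseyProp p q r' → r ≤ r')

record Theta (G : Graph) : Set where
  field
    s t    : V G
    nonadj : ¬ E G s t
    P      : Fin 3 → Path G
    ends   : ∀ i → start (P i) ≡ s × finish (P i) ≡ t
    long   : ∀ i → 2 ≤ len (P i)
    sep    : ∀ i j → i ≢ j → ∀ x y → interior (P i) x → interior (P j) y →
               x ≢ y × ¬ E G x y

record Prism (G : Graph) : Set where
  field
    a b   : Fin 3 → V G
    P     : Fin 3 → Path G
    ends  : ∀ i → start (P i) ≡ a i × finish (P i) ≡ b i
    triA  : ∀ i j → i ≢ j → E G (a i) (a j)
    triB  : ∀ i j → i ≢ j → E G (b i) (b j)
    disjT : ∀ i j → a i ≢ b j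
    sep   : ∀ i j → i ≢ j → ∀ x y → onPath (P i) x → onPath (P j) y →
              x ≢ y × (E G x y → (x ≡ a i × y ≡ a j) ⊎ (x ≡ b i × y ≡ b j))

ThetaFree : Graph → Set
ThetaFree G = ¬ Theta G

PrismFree : Graph → Set
PrismFree G = ¬ Prism G

record Pyramid (G : Graph) : Set where
  field
    apex  : V G
    b     : Fin 3 → V G
    P     : Fin 3 → Path G
    ends  : ∀ i → start (P i) ≡ apex × finish (P i) ≡ b i
    pos   : ∀ i → 1 ≤ len (P i)
    tri   : ∀ i j → i ≢ j → E G (b i) (b j)
    sep   : ∀ i j → i ≢ j → ∀ x y → onPath (P i) x → onPath (P j) y →
              x ≢ apex → y ≢ apex → x ≢ y × (E G x y → x ≡ b i × y ≡ b j)
    short : ∀ i j → i ≢ j → len (P i) ≡ 1 → len (P j) ≡ 1 → ⊥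

open Pyramid

PyrJewel : (G : Graph) → Pyramid G → Fin 3 → V G → Set
PyrJewel G Σp i p =
  (∀ k → ¬ onPath (P Σp k) p) ×
  (∀ x → onPath (P Σp i) x → ¬ E G p x) ×
  (∀ k → k ≢ i → ∀ x → onPath (P Σp k) x →
     Iff (E G p x) (x ≡ b Σp k ⊎ E G (b Σp k) x))

record Cycle (G : Graph) : Set where
  field
    k    : ℕ
    c    : Fin (3 + k) → V G
    inj  : ∀ i j → c i ≡ c j → i ≡ j
    step : ∀ (i : Fin (2 + k)) → E G (c (inject₁ i)) (c (suc i))
    wrap : E G (c (fromℕ (2 + k))) (c zero)

Connected : Graph → Set
Connected G = ∀ u v → Σ (Path G) λ P → start P ≡ u × finish P ≡ v

Tree : Graph → Set
Tree T = Connected T × ¬ Cycle T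

Smooth : Graph → Set
Smooth T = 3 ≤ n T × (∀ v → deg T v ≡ 1 ⊎ 2 < deg T v)

MaxDeg : Graph → ℕ → Set
MaxDeg T δ = (∀ v → deg T v ≤ δ) × (∃[ v ] deg T v ≡ δ)

SameEdge : ∀ {A : Set} → A → A → A → A → Set
SameEdge x y u w = (x ≡ u × y ≡ w) ⊎ (x ≡ w × y ≡ u)

ReachAvoid : (T : Graph) → V T → V T → V T → V T → Set
ReachAvoid T u w x y = Σ (Path T) λ P → start P ≡ x × finish P ≡ y ×
  (∀ (k : Fin (len P)) → ¬ SameEdge (vx P (inject₁ k)) (vx P (suc k)) u w)

-- Strip structures.  An edge of T is represented by an ordered pair
-- (u,w) of adjacent vertices; zE, zEV are required to be symmetric.

record ZetaMap (G T : Graph) : Set where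
  field
    zV  : V T → V G → Bool
    zE  : V T → V T → V G → Bool
    zEV : V T → V T → V T → V G → Bool

open ZetaMap public

module _ {G T : Graph} (ζ : ZetaMap G T) where

  inV : V T → V G → Set
  inV v x = zV ζ v x ≡ true

  inE : V T → V T → V G → Set
  inE u w x = zE ζ u w x ≡ true

  inEV : V T → V T → V T → V G → Set
  inEV u w v x = zEV ζ u w v x ≡ true

  inEo : V T → V T → V G → Set
  inEo u w x = inE u w x × ¬ inEV u w u x × ¬ inEV u w w x

  inB : V T → V G → Set
  inB v x = ∃[ w ] (E T v w × inEV v w v x)

  inZT : V G → Set
  inZT x = (∃[ v ] inV v x) ⊎ (∃[ u ] ∃[ w ] (E T u w × inE u w x))

  inZT+ : V G → V G → Set
  inZT+ a x = x ≡ a ⊎ inZT x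

  S5Path : V T → V T → V G → Set
  S5Path u w x = Σ (Path G) λ P → start P ≡ x × inEV u w u (finish P) ×
    (∀ y → onPath P y → inE u w y) × (∀ y → interior P y → inEo u w y)

  record IsStrip (a : V G) : Set where
    field
      symE   : ∀ u w → E T u w → ∀ x → zE ζ u w x ≡ zE ζ w u x
      symEV  : ∀ u w → E T u w → ∀ v x → zEV ζ u w v x ≡ zEV ζ w u v x
      noaV   : ∀ v → ¬ inV v a
      noaE   : ∀ u w → E T u w → ¬ inE u w a
      noaEV  : ∀ u w → E T u w → ∀ v → ¬ inEV u w v a
      s1VV   : ∀ v v' → v ≢ v' → ∀ x → inV v x → inV v' x → ⊥
      s1VE   : ∀ v u w → E T u w → ∀ x → inV v x → inE u w x → ⊥
      s1EE   : ∀ u w u' w' → E T u w → E T u' w' → ¬ SameEdge u w u' w' →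
                 ∀ x → inE u w x → inE u' w' x → ⊥
      s2     : ∀ l → Leaf T l → ∀ x → ¬ inV l x
      s3sub  : ∀ u w → E T u w → ∀ v x → inEV u w v x → inE u w x
      s3ne   : ∀ u w → E T u w → ∀ v → Iff (∃[ x ] inEV u w v x) (v ≡ u ⊎ v ≡ w)
      s4comp : ∀ u w u' w' → E T u w → E T u' w' → ¬ SameEdge u w u' w' →
                 ∀ v x y → inEV u w v x → inEV u' w' v y → E G x y
      s4only : ∀ u w u' w' → E T u w → E T u' w' → ¬ SameEdge u w u' w' →
                 ∀ x y → inE u w x → inE u' w' y → E G x y →
                 ∃[ v ] (inEV u w v x × inEV u' w' v y)
      s5     : ∀ u w → E T u w → ∀ x → inE u w x → S5Path u w x × S5Path w u x
      s6     : ∀ v u w → E T u w → ∀ x y → inV v x → inE u w y →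
                 ¬ inEV u w v y → ¬ E G x y
      -- (S7): the component of G[ζ(v)] containing x has a neighbour in B(v)
      s7     : ∀ v x → inV v x → Σ (Path G) λ P → start P ≡ x ×
                 (∀ y → onPath P y → inV v y) ×
                 ∃[ z ] (inB v z × E G (finish P) z)
      s8comp : ∀ l w → Leaf T l → E T l w → ∀ x → inEV l w l x → E G a x
      s8only : ∀ x → inZT x → E G a x →
                 ∃[ l ] ∃[ w ] (Leaf T l × E T l w × inEV l w l x)

  Trapped : V G → Set
  Trapped a =
    (∀ x → (x ≡ a ⊎ E G a x ⊎ ∃[ y ] (E G a y × E G y x)) → inZT+ a x) ×
    (∀ y → E G a y → ∃[ z₁ ] ∃[ z₂ ] (z₁ ≢ z₂ ×
        inZT+ a z₁ × E G y z₁ × inZT+ a z₂ × E G y z₂ ×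
        (∀ z → inZT+ a z → E G y z → z ≡ z₁ ⊎ z ≡ z₂)))

  Rich : V G → Set
  Rich a = Trapped a ×
    (∀ l w → Leaf T l → E T l w →
       ∃[ x ] (inEV l w l x × (∀ y → inEV l w l y → y ≡ x)))

  IsRung : V T → V T → Path G → Set
  IsRung u w R = (∀ y → onPath R y → inE u w y) ×
    ((len R ≡ 0 × inEV u w u (start R) × inEV u w w (start R)) ⊎
     (((inEV u w u (start R) × ¬ inEV u w w (start R) ×
        inEV u w w (finish R) × ¬ inEV u w u (finish R)) ⊎
       (inEV u w w (start R) × ¬ inEV u w u (start R) ×
        inEV u w u (finish R) × ¬ inEV u w w (finish R))) ×
      (∀ y → interior R y → inEo u w y)))

  record ZPyramid (a : V G) (v : V T) (w : Fin 3 → V T) : Set where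
    field
      pyr     : Pyramid G
      apexA   : apex pyr ≡ a
      baseIn  : ∀ i → inEV v (w i) v (b pyr i)
      leaf    : Fin 3 → V T
      isLeaf  : ∀ i → Leaf T (leaf i)
      side    : ∀ i → ¬ ReachAvoid T v (w i) v (leaf i)
      Λ       : Fin 3 → Path T
      Λends   : ∀ i → start (Λ i) ≡ v × finish (Λ i) ≡ leaf i
      Γin     : ∀ i x → onPath (P pyr i) x → x ≢ a →
                  ∃[ k ] inE (vx (Λ i) (inject₁ k)) (vx (Λ i) (suc k)) x
      rungs   : ∀ i (k : Fin (len (Λ i))) → Σ (Path G) λ R →
                  IsRung (vx (Λ i) (inject₁ k)) (vx (Λ i) (suc k)) R ×
                  (∀ x → Iff (onPath R x)
                     (onPath (P pyr i) x × x ≢ a ×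
                      inE (vx (Λ i) (inject₁ k)) (vx (Λ i) (suc k)) x)) ×
                  (SameEdge (vx (Λ i) (inject₁ k)) (vx (Λ i) (suc k)) v (w i) →
                     1 ≤ len R)

  ZJewel : V G → V T → V T → V T → V G → Set
  ZJewel a v w₁ w₂ p = ¬ inZT+ a p ×
    ∃[ w₃ ] (E T v w₃ × w₃ ≢ w₁ × w₃ ≢ w₂ ×
      Σ (ZPyramid a v (tri3 w₁ w₂ w₃)) λ Z →
        PyrJewel G (ZPyramid.pyr Z) (suc (suc zero)) p)

  InJ : V G → V T → V G → Set
  InJ a v p = ∃[ w₁ ] ∃[ w₂ ] (E T v w₁ × E T v w₂ × w₁ ≢ w₂ × ZJewel a v w₁ w₂ p)

CardLt : (G : Graph) → (V G → Set) → ℕ → Set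
CardLt G X j = ∀ k (f : Fin k → V G) → (∀ i i' → f i ≡ f i' → i ≡ i') →
  (∀ i → X (f i)) → k < j

Bound : ℕ → ℕ → ℕ → Set
Bound t δ j = ∀ (G : Graph) → ThetaFree G → PrismFree G → ¬ HasClique G t →
  ∀ (a : V G) (T : Graph) → Tree T → Smooth T → MaxDeg T δ →
  ∀ (ζ : ZetaMap G T) → IsStrip ζ a → Rich ζ a →
  ∀ (v : V T) → CardLt G (InJ ζ a v) j

{-# OPTIONS --safe #-}
-- Let p be a jewel at (v, e₁, e₂) for a pyramid with legs P₁, P₂, P₃. Replacing the rung of P₁ in ζ(e₁)
-- by any other long rung gives a pyramid with legs y, P₂, P₃ (shortcuts being taken along y), and p is
-- again adjacent to the first two vertices of y and to nothing else on y. Indeed, if p has neighbours on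
-- y but not exactly these, there is a theta or a prism. If p has none, follow P₁ from p to the first
-- vertex h with a neighbour on y; by the same argument h is adjacent to exactly y₀ and y₁, and then
-- the triangles h y₀ y₁ and p b₂ b₂′ are joined by a prism.
--
-- So all jewels at one unordered seagull are complete to b₁ and to the neighbour b₂′ of b₂ on P₂, for
-- one fixed pyramid. As b₁ and b₂′ are non-adjacent, three pairwise non-adjacent jewels would form
-- a theta K₂,₃. Ramsey's theorem and the pigeonhole principle over the pairs of edges at v conclude.
module Submission where

open import Defs
open import Data.Nat using (ℕ; zero; suc; pred; _+_; _*_; _∸_; _⊔_; _⊓_; _≤_; _<_; z≤n; s≤s; _<?_)
open import Data.Nat.Combinatorics using (_C_; nC1≡n; nCk+nC[k+1]≡[n+1]C[k+1])
open import Data.Nat.Properties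
open import Data.Fin using (Fin; zero; suc; toℕ; fromℕ; inject₁; inject≤; fromℕ<)
open import Data.Fin.Properties as Fin using (toℕ<n; toℕ-injective; toℕ-fromℕ<; toℕ-fromℕ; any?)
open import Data.Bool using (Bool; true; if_then_else_)
import Data.Bool.Properties as Bool
open import Data.Product using (Σ; ∃-syntax; _×_; _,_; proj₁; proj₂; swap)
open import Data.Sum using (_⊎_; inj₁; inj₂; [_,_]′)
open import Data.Unit using (⊤; tt)
open import Data.Empty using (⊥; ⊥-elim)
open import Relation.Nullary using (¬_; Dec; yes; no)
open import Relation.Nullary.Decidable using (_⊎-dec_; _×-dec_)
open import Relation.Binary.Definitions using (tri<; tri≈; tri>)
open import Relation.Binary.PropositionalEquality using (_≡_; _≢_; refl; trans; cong; subst; subst₂; ≢-sym)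
  renaming (sym to ≡-sym)

-- Jewels at one seagull come with different pyramids, possibly with different third edges, so their
-- attachments cannot be compared directly. A rung can be moved from one pyramid to another because
-- all vertices of `ζ(e,w)` have the same neighbours beyond the strip: the rung of one leg is
-- continued by the tail of another. In this way every jewel is tested against the rungs of a single
-- pyramid.
--
-- The obstacle is the region around the apex. The thetas of the attachment argument end at `a`, so
-- an attaching vertex must see neither `a` nor the neighbour of `a` on the new leg. Richness
-- provides this. A jewel lies outside `ζ⁺(T)`, hence at distance more than two from `a`; for a
-- vertex of the old leg, it matters that neighbours of `a` have degree two and that leaf ends are
-- single vertices.

-- Walks and induced paths

E-sym : ∀ G {x y} → E G x y → E G y x
E-sym G {x} {y} e = trans (sym G y x) e

E-irrefl : ∀ G {x} → ¬ E G x x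
E-irrefl G {x} e with trans (≡-sym e) (irrefl G x)
... | ()

E? : ∀ G x y → Dec (E G x y)
E? G x y = adj G x y Bool.≟ true

-- Thetas and prisms need induced paths, but their separation conditions only concern sets
-- containing the paths. Walks confined to `X` can be concatenated freely; `inducedPath` then finds
-- an induced path inside `X`, so chords never have to be excluded by hand.
data Walk (G : Graph) (X : V G → Set) : V G → V G → Set where
  stop : ∀ {x} → X x → Walk G X x x
  step : ∀ {x y z} → X x → E G x y → Walk G X y z → Walk G X x z

module _ {G : Graph} {X : V G → Set} where

  _++ʷ_ : ∀ {x y z} → Walk G X x y → Walk G X y z → Walk G X x z
  stop _ ++ʷ w = w
  step Xx e w′ ++ʷ w = step Xx e (w′ ++ʷ w)

  headʷ : ∀ {x y} → Walk G X x y → X x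
  headʷ (stop Xx) = Xx
  headʷ (step Xx _ _) = Xx

  reverseʷ : ∀ {x y} → Walk G X x y → Walk G X y x
  reverseʷ (stop Xx) = stop Xx
  reverseʷ (step Xx e w) = reverseʷ w ++ʷ step (headʷ w) (E-sym G e) (stop Xx)

  lastʷ : ∀ {x y} → Walk G X x y → X y
  lastʷ w = headʷ (reverseʷ w)

  joinʷ : ∀ {x y z t} → Walk G X x y → E G y z → Walk G X z t → Walk G X x t
  joinʷ w e w′ = w ++ʷ step (lastʷ w) e w′

  rangeʷ : (u : ℕ → V G) → ∀ {i j} → i ≤ j →
           (∀ k → i ≤ k → k < j → E G (u k) (u (suc k))) →
           (∀ k → i ≤ k → k ≤ j → X (u k)) → Walk G X (u i) (u j)
  rangeʷ u {i} {j} i≤j e Xu with m≤n⇒m<n∨m≡n i≤j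
  rangeʷ u {i} {suc j} _ e Xu | inj₁ (s≤s i≤j) =
    joinʷ (rangeʷ u i≤j (λ k i≤k k<j → e k i≤k (m<n⇒m<1+n k<j)) (λ k i≤k k≤j → Xu k i≤k (m≤n⇒m≤1+n k≤j)))
      (e j i≤j ≤-refl) (stop (Xu (suc j) (m≤n⇒m≤1+n i≤j) ≤-refl))
  ... | inj₂ refl = stop (Xu i ≤-refl ≤-refl)

mapʷ : ∀ {G X Y x y} → (∀ v → X v → Y v) → Walk G X x y → Walk G Y x y
mapʷ f (stop Xx) = stop (f _ Xx)
mapʷ f (step Xx e w) = step (f _ Xx) e (mapʷ f w)

InducedIn : (G : Graph) → (V G → Set) → V G → V G → Set
InducedIn G X x y = Σ (Path G) λ P → start P ≡ x × finish P ≡ y × (∀ i → X (vx P i))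

module _ {G : Graph} {X : V G → Set} where

  singletonPath : ∀ x → X x → InducedIn G X x x
  singletonPath x Xx = record
    { len = 0 ; vx = λ _ → x ; inj = λ { zero zero _ → refl }
    ; adjIff = λ { zero zero → (λ e → ⊥-elim (E-irrefl G e)) , λ { (inj₁ ()) ; (inj₂ ()) } } }
    , refl , refl , λ _ → Xx

  consPath : ∀ (P : Path G) x → (∀ i → x ≢ vx P i) → E G x (start P) →
             (∀ i → i ≢ zero → ¬ E G x (vx P i)) → Path G
  consPath P x x∉P e x≁P = record { len = suc (len P) ; vx = f ; inj = f-inj ; adjIff = f-adj }
    where
    f : Fin (suc (suc (len P))) → V G
    f zero = x
    f (suc i) = vx P i
    f-inj : ∀ i j → f i ≡ f j → i ≡ j
    f-inj zero zero _ = refl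
    f-inj zero (suc j) eq = ⊥-elim (x∉P j eq)
    f-inj (suc i) zero eq = ⊥-elim (x∉P i (≡-sym eq))
    f-inj (suc i) (suc j) eq = cong suc (inj P i j eq)
    new : ∀ i → Iff (E G x (vx P i)) (0 ≡ suc (toℕ (suc i)) ⊎ toℕ (suc i) ≡ 1)
    new zero = (λ _ → inj₂ refl) , λ _ → e
    new (suc i) = (λ e′ → ⊥-elim (x≁P (suc i) (λ ()) e′)) , λ { (inj₁ ()) ; (inj₂ ()) }
    f-adj : ∀ i j → Iff (E G (f i) (f j)) (toℕ i ≡ suc (toℕ j) ⊎ toℕ j ≡ suc (toℕ i))
    f-adj zero zero = (λ e′ → ⊥-elim (E-irrefl G e′)) , λ { (inj₁ ()) ; (inj₂ ()) }
    f-adj zero (suc j) = new j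
    f-adj (suc i) zero =
      (λ e′ → [ inj₂ , inj₁ ]′ (proj₁ (new i) (E-sym G e′))) ,
      λ s → E-sym G (proj₂ (new i) ([ inj₂ , inj₁ ]′ s))
    f-adj (suc i) (suc j) =
      (λ e′ → [ (λ q → inj₁ (cong suc q)) , (λ q → inj₂ (cong suc q)) ]′ (proj₁ (adjIff P i j) e′)) ,
      λ s → proj₂ (adjIff P i j) ([ (λ q → inj₁ (cong pred q)) , (λ q → inj₂ (cong pred q)) ]′ s)

  -- The new first vertex x is joined to the last vertex of the path that it meets or is adjacent to.
  attach : ∀ n (P : Path G) → len P ≡ n → (∀ i → X (vx P i)) → ∀ x → X x →
           (∃[ k ] (x ≡ vx P k ⊎ E G x (vx P k))) → InducedIn G X x (finish P)
  attach zero record { len = zero ; vx = f ; inj = I ; adjIff = A } refl XP x Xx (zero , inj₁ refl) =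
    record { len = zero ; vx = f ; inj = I ; adjIff = A } , refl , refl , XP
  attach zero P@record { len = zero ; vx = f } refl XP x Xx (zero , inj₂ e) =
    consPath P x (λ { zero refl → E-irrefl G e }) e (λ { zero ne _ → ne refl }) ,
    refl , refl , λ { zero → Xx ; (suc i) → XP i }
  attach (suc n) P@record { len = suc n ; vx = f ; inj = I ; adjIff = A } refl XP x Xx (k , t) = go
    where
    tail : Path G
    tail = record
      { len = n ; vx = λ i → f (suc i) ; inj = λ i j eq → Fin.suc-injective (I (suc i) (suc j) eq)
      ; adjIff = λ i j →
          (λ e → [ (λ q → inj₁ (cong pred q)) , (λ q → inj₂ (cong pred q)) ]′ (proj₁ (A (suc i) (suc j)) e)) ,
          λ s → proj₂ (A (suc i) (suc j)) ([ (λ q → inj₁ (cong suc q)) , (λ q → inj₂ (cong suc q)) ]′ s) }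
    atHead : ¬ (∃[ j ] (x ≡ f (suc j) ⊎ E G x (f (suc j)))) → ∀ k → x ≡ f k ⊎ E G x (f k) →
             InducedIn G X x (finish P)
    atHead none (suc k) t = ⊥-elim (none (k , t))
    atHead none zero (inj₁ eq) = P , ≡-sym eq , refl , XP
    atHead none zero (inj₂ e) =
      consPath P x (λ { zero refl → E-irrefl G e ; (suc j) eq → none (j , inj₁ eq) }) e
        (λ { zero ne _ → ne refl ; (suc j) _ e′ → none (j , inj₂ e′) }) ,
      refl , refl , λ { zero → Xx ; (suc i) → XP i }
    go : InducedIn G X x (finish P)
    go with any? (λ j → (x Fin.≟ f (suc j)) ⊎-dec E? G x (f (suc j)))
    ... | yes t′ = attach n tail refl (λ i → XP (suc i)) x Xx t′
    ... | no none = atHead none k t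

  inducedPath : ∀ {x y} → Walk G X x y → InducedIn G X x y
  inducedPath (stop Xx) = singletonPath _ Xx
  inducedPath (step {x} Xx e w) with inducedPath w
  ... | P , refl , refl , XP = attach (len P) P refl XP x Xx (zero , inj₂ e)

-- Thetas and prisms from separated walks

Pred : Graph → Set₁
Pred G = V G → Set

With : (G : Graph) → V G → Pred G → Pred G
With G h Q v = v ≡ h ⊎ Q v

Apart : (G : Graph) → Pred G → Pred G → Set
Apart G X Y = ∀ x y → X x → Y y → x ≢ y × ¬ E G x y

Apart-sym : ∀ {G X Y} → Apart G X Y → Apart G Y X
Apart-sym {G} A x y Yx Xy = (λ eq → proj₁ (A y x Xy Yx) (≡-sym eq)) , λ e → proj₂ (A y x Xy Yx) (E-sym G e)

Apart-∪ : ∀ {G X Y Z} → Apart G X Z → Apart G Y Z → Apart G (λ v → X v ⊎ Y v) Z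
Apart-∪ A B x y (inj₁ Xx) Zy = A x y Xx Zy
Apart-∪ A B x y (inj₂ Yx) Zy = B x y Yx Zy

EndsOr : ∀ {G : Graph} → V G → V G → Pred G → Pred G
EndsOr s t X v = v ≡ s ⊎ v ≡ t ⊎ X v

fin3 : ∀ {ℓ} {A : Fin 3 → Set ℓ} → A zero → A (suc zero) → A (suc (suc zero)) → ∀ i → A i
fin3 x y z zero = x
fin3 x y z (suc zero) = y
fin3 x y z (suc (suc zero)) = z

triple : ∀ {ℓ} {A : Set ℓ} → A → A → A → Fin 3 → A
triple x y z = fin3 x y z

module _ {G : Graph} where

  long-induced : ∀ {Y : Pred G} {s t} → s ≢ t → ¬ E G s t → (R : InducedIn G Y s t) → 2 ≤ len (proj₁ R)
  long-induced s≢t s≁t (record { len = zero } , refl , refl , _) = ⊥-elim (s≢t refl)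
  long-induced s≢t s≁t (record { len = suc zero ; adjIff = A } , refl , refl , _) =
    ⊥-elim (s≁t (proj₂ (A zero (suc zero)) (inj₂ refl)))
  long-induced s≢t s≁t (record { len = suc (suc n) } , _) = s≤s (s≤s z≤n)

  -- Since `s` and `t` are distinct and non-adjacent, each extracted path has length at least two.
  -- An injective path meets its ends only once, so its interior falls into the third alternative of
  -- `EndsOr`, and apartness of the `Xᵢ` is all that remains.
  thetaFromWalks : ThetaFree G → ∀ s t → s ≢ t → ¬ E G s t → (X₁ X₂ X₃ : Pred G) →
    Walk G (EndsOr {G} s t X₁) s t → Walk G (EndsOr {G} s t X₂) s t → Walk G (EndsOr {G} s t X₃) s t →
    Apart G X₁ X₂ → Apart G X₁ X₃ → Apart G X₂ X₃ → ⊥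
  thetaFromWalks θ s t s≢t s≁t X₁ X₂ X₃ w₁ w₂ w₃ A₁₂ A₁₃ A₂₃ = θ record
    { s = s ; t = t ; nonadj = s≁t ; P = λ i → proj₁ (Q i)
    ; ends = λ i → proj₁ (proj₂ (Q i)) , proj₁ (proj₂ (proj₂ (Q i)))
    ; long = λ i → long-induced {EndsOr {G} s t (X i)} s≢t s≁t (Q i)
    ; sep = λ i j i≢j x y ix iy → apart i j i≢j x y (inside i x ix) (inside j y iy) }
    where
    X : Fin 3 → Pred G
    X = triple X₁ X₂ X₃
    Q : ∀ i → InducedIn G (EndsOr {G} s t (X i)) s t
    Q = fin3 {A = λ i → InducedIn G (EndsOr {G} s t (X i)) s t} (inducedPath w₁) (inducedPath w₂) (inducedPath w₃)
    within : ∀ {Y : Pred G} (R : InducedIn G (EndsOr {G} s t Y) s t) x → interior (proj₁ R) x → Y x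
    within (P , refl , refl , XP) x (i , 0<i , i<l , refl) with XP i
    ... | inj₁ eq with inj P i zero eq
    ...   | refl = ⊥-elim (<-irrefl refl 0<i)
    within (P , refl , refl , XP) x (i , 0<i , i<l , refl) | inj₂ (inj₁ eq) with inj P i (fromℕ (len P)) eq
    ...   | refl = ⊥-elim (<-irrefl (toℕ-fromℕ (len P)) i<l)
    within (P , refl , refl , XP) x (i , 0<i , i<l , refl) | inj₂ (inj₂ Yx) = Yx
    inside : ∀ i x → interior (proj₁ (Q i)) x → X i x
    inside i = within {X i} (Q i)
    apart : ∀ i j → i ≢ j → Apart G (X i) (X j)
    apart zero zero i≢j = ⊥-elim (i≢j refl)
    apart zero (suc zero) _ = A₁₂
    apart zero (suc (suc zero)) _ = A₁₃
    apart (suc zero) zero _ = Apart-sym {G} {X₁} {X₂} A₁₂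
    apart (suc zero) (suc zero) i≢j = ⊥-elim (i≢j refl)
    apart (suc zero) (suc (suc zero)) _ = A₂₃
    apart (suc (suc zero)) zero _ = Apart-sym {G} {X₁} {X₃} A₁₃
    apart (suc (suc zero)) (suc zero) _ = Apart-sym {G} {X₂} {X₃} A₂₃
    apart (suc (suc zero)) (suc (suc zero)) i≢j = ⊥-elim (i≢j refl)

  Linked : Pred G → Pred G → V G → V G → V G → V G → Set
  Linked X Y a a′ b b′ = ∀ x y → X x → Y y →
    x ≢ y × (E G x y → (x ≡ a × y ≡ a′) ⊎ (x ≡ b × y ≡ b′))

  Linked-sym : ∀ {X Y a a′ b b′} → Linked X Y a a′ b b′ → Linked Y X a′ a b′ b
  Linked-sym L x y Yx Xy =
    (λ eq → proj₁ (L y x Xy Yx) (≡-sym eq)) ,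
    λ e → [ (λ { (p , q) → inj₁ (q , p) }) , (λ { (p , q) → inj₂ (q , p) }) ]′ (proj₂ (L y x Xy Yx) (E-sym G e))

  prismFromWalks : PrismFree G → ∀ {a₁ a₂ a₃ b₁ b₂ b₃} {X₁ X₂ X₃ : Pred G} →
    E G a₁ a₂ → E G a₁ a₃ → E G a₂ a₃ → E G b₁ b₂ → E G b₁ b₃ → E G b₂ b₃ →
    a₁ ≢ b₁ → a₂ ≢ b₂ → a₃ ≢ b₃ →
    Walk G X₁ a₁ b₁ → Walk G X₂ a₂ b₂ → Walk G X₃ a₃ b₃ →
    Linked X₁ X₂ a₁ a₂ b₁ b₂ → Linked X₁ X₃ a₁ a₃ b₁ b₃ → Linked X₂ X₃ a₂ a₃ b₂ b₃ → ⊥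
  prismFromWalks π {a₁} {a₂} {a₃} {b₁} {b₂} {b₃} {X₁} {X₂} {X₃}
    a₁₂ a₁₃ a₂₃ b₁₂ b₁₃ b₂₃ d₁ d₂ d₃ w₁ w₂ w₃ L₁₂ L₁₃ L₂₃ = π record
    { a = a ; b = b ; P = λ i → proj₁ (Q i)
    ; ends = λ i → proj₁ (proj₂ (Q i)) , proj₁ (proj₂ (proj₂ (Q i)))
    ; triA = clique a₁₂ a₁₃ a₂₃ ; triB = clique b₁₂ b₁₃ b₂₃
    ; disjT = disj
    ; sep = λ { i j i≢j x y (k , refl) (l , refl) →
        linked i j i≢j x y (proj₂ (proj₂ (proj₂ (Q i))) k) (proj₂ (proj₂ (proj₂ (Q j))) l) } }
    where
    a b : Fin 3 → V G
    a = triple a₁ a₂ a₃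
    b = triple b₁ b₂ b₃
    X : Fin 3 → Pred G
    X = triple X₁ X₂ X₃
    w : ∀ i → Walk G (X i) (a i) (b i)
    w = fin3 {A = λ i → Walk G (X i) (a i) (b i)} w₁ w₂ w₃
    Q : ∀ i → InducedIn G (X i) (a i) (b i)
    Q i = inducedPath (w i)
    clique : ∀ {c₁ c₂ c₃} → E G c₁ c₂ → E G c₁ c₃ → E G c₂ c₃ →
      ∀ i j → i ≢ j → E G (triple c₁ c₂ c₃ i) (triple c₁ c₂ c₃ j)
    clique c₁₂ c₁₃ c₂₃ zero zero i≢j = ⊥-elim (i≢j refl)
    clique c₁₂ c₁₃ c₂₃ zero (suc zero) _ = c₁₂
    clique c₁₂ c₁₃ c₂₃ zero (suc (suc zero)) _ = c₁₃
    clique c₁₂ c₁₃ c₂₃ (suc zero) zero _ = E-sym G c₁₂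
    clique c₁₂ c₁₃ c₂₃ (suc zero) (suc zero) i≢j = ⊥-elim (i≢j refl)
    clique c₁₂ c₁₃ c₂₃ (suc zero) (suc (suc zero)) _ = c₂₃
    clique c₁₂ c₁₃ c₂₃ (suc (suc zero)) zero _ = E-sym G c₁₃
    clique c₁₂ c₁₃ c₂₃ (suc (suc zero)) (suc zero) _ = E-sym G c₂₃
    clique c₁₂ c₁₃ c₂₃ (suc (suc zero)) (suc (suc zero)) i≢j = ⊥-elim (i≢j refl)
    linked : ∀ i j → i ≢ j → Linked (X i) (X j) (a i) (a j) (b i) (b j)
    linked zero zero i≢j = ⊥-elim (i≢j refl)
    linked zero (suc zero) _ = L₁₂
    linked zero (suc (suc zero)) _ = L₁₃
    linked (suc zero) zero _ = Linked-sym L₁₂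
    linked (suc zero) (suc zero) i≢j = ⊥-elim (i≢j refl)
    linked (suc zero) (suc (suc zero)) _ = L₂₃
    linked (suc (suc zero)) zero _ = Linked-sym L₁₃
    linked (suc (suc zero)) (suc zero) _ = Linked-sym L₂₃
    linked (suc (suc zero)) (suc (suc zero)) i≢j = ⊥-elim (i≢j refl)
    disj : ∀ i j → a i ≢ b j
    -- Off the diagonal, linkedness already separates `a i` from `b j`; the hypotheses `dᵢ` cover
    -- the diagonal.
    disj i j with i Fin.≟ j
    disj zero j | yes refl = d₁
    disj (suc zero) j | yes refl = d₂
    disj (suc (suc zero)) j | yes refl = d₃
    ... | no i≢j = proj₁ (linked i j i≢j (a i) (b j) (headʷ (w i)) (lastʷ (w j)))

least : ∀ {P : ℕ → Set} → (∀ k → Dec (P k)) → ∀ n → P n →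
        ∃[ m ] (m ≤ n × P m × (∀ k → k < m → ¬ P k))
least P? zero P0 = 0 , z≤n , P0 , λ _ ()
least {P} P? (suc n) Pn with P? 0
... | yes P0 = 0 , z≤n , P0 , λ _ ()
... | no ¬P0 with least (λ k → P? (suc k)) n Pn
...   | m , m≤n , Pm , min = suc m , s≤s m≤n , Pm , λ { zero _ → ¬P0 ; (suc k) (s≤s k<m) → min k k<m }

greatest : ∀ {P : ℕ → Set} → (∀ k → Dec (P k)) → ∀ N {j} → j ≤ N → P j →
           ∃[ m ] (j ≤ m × m ≤ N × P m × (∀ k → m < k → k ≤ N → ¬ P k))
greatest P? N j≤N Pj with P? N
... | yes PN = N , j≤N , ≤-refl , PN , λ k N<k k≤N → ⊥-elim (<-irrefl refl (<-≤-trans N<k k≤N))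
greatest P? zero z≤n Pj | no ¬PN = ⊥-elim (¬PN Pj)
greatest P? (suc N) j≤N Pj | no ¬PN with m≤n⇒m<n∨m≡n j≤N
... | inj₂ refl = ⊥-elim (¬PN Pj)
... | inj₁ (s≤s j≤N′) with greatest P? N j≤N′ Pj
...   | m , j≤m , m≤N , Pm , max = m , j≤m , m≤n⇒m≤1+n m≤N , Pm , above
  where
  above : ∀ k → m < k → k ≤ suc N → ¬ _
  above k m<k k≤ with m≤n⇒m<n∨m≡n k≤
  ... | inj₁ (s≤s k≤N) = max k m<k k≤N
  ... | inj₂ refl = ¬PN

-- Attachments to a pyramid

-- A leg of a pyramid with apex a, indexed from its base vertex u 0 to a = u M; values beyond M are junk.
record Arm (G : Graph) (a : V G) (M : ℕ) (u : ℕ → V G) : Set where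
  field
    top      : u M ≡ a
    long     : 2 ≤ M
    distinct : ∀ {i j} → i ≤ M → j ≤ M → u i ≡ u j → i ≡ j
    near     : ∀ {i j} → i ≤ M → j ≤ M → E G (u i) (u j) → i ≡ suc j ⊎ j ≡ suc i
    link     : ∀ {i} → i < M → E G (u i) (u (suc i))

-- The bounds are strict because two legs share the apex at their last indices.
record Meet (G : Graph) (M : ℕ) (u : ℕ → V G) (M′ : ℕ) (u′ : ℕ → V G) : Set where
  field
    base : E G (u 0) (u′ 0)
    disj : ∀ {k l} → k < M → l < M′ → u k ≢ u′ l
    only : ∀ {k l} → k < M → l < M′ → E G (u k) (u′ l) → k ≡ 0 × l ≡ 0

Seg : ∀ {G : Graph} → (ℕ → V G) → ℕ → ℕ → Pred G
Seg u i j v = ∃[ k ] (i ≤ k × k < j × v ≡ u k)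

module _ {G : Graph} {a : V G} {M : ℕ} {u : ℕ → V G} (U : Arm G a M u) where
  open Arm U

  ascend : ∀ {X : Pred G} {i j} → i ≤ j → j ≤ M → (∀ k → i ≤ k → k ≤ j → X (u k)) → Walk G X (u i) (u j)
  ascend i≤j j≤M Xu = rangeʷ u i≤j (λ k _ k<j → link (<-≤-trans k<j j≤M)) Xu

  ascendTop : ∀ {X : Pred G} {i} → i ≤ M → (∀ k → i ≤ k → k < M → X (u k)) → X a → Walk G X (u i) a
  ascendTop {X} {i} i≤M Xu Xa = subst (Walk G X (u i)) top (ascend i≤M ≤-refl below)
    where
    below : ∀ k → i ≤ k → k ≤ M → X (u k)
    below k i≤k k≤M with m≤n⇒m<n∨m≡n k≤M
    ... | inj₁ k<M = Xu k i≤k k<M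
    ... | inj₂ refl = subst X (≡-sym top) Xa

  top-apart : ∀ {k} → k < M → u k ≢ a
  top-apart k<M eq = <-irrefl (distinct (<⇒≤ k<M) ≤-refl (trans eq (≡-sym top))) k<M

  top-near : ∀ {k} → k ≤ M → E G (u k) a → suc k ≡ M
  top-near {k} k≤M e with near k≤M ≤-refl (subst (E G (u k)) (≡-sym top) e)
  ... | inj₁ refl = ⊥-elim (<-irrefl refl k≤M)
  ... | inj₂ eq = ≡-sym eq

  apart-within : ∀ {i j i′ j′} → j < i′ → j′ ≤ suc M → Apart G (Seg {G} u i j) (Seg {G} u i′ j′)
  apart-within {i} {j} {i′} {j′} j<i′ j′≤ x y (k , _ , k<j , refl) (l , i′≤l , l<j′ , refl) =
    (λ eq → <-irrefl (distinct k≤M l≤M eq) k<l) , λ e → 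
      [ (λ eq → <-asym k<l (subst (l <_) (≡-sym eq) ≤-refl)) , (λ eq → <-irrefl (≡-sym eq) sk<l) ]′ (near k≤M l≤M e)
    where
    sk<l : suc k < l
    sk<l = ≤-<-trans k<j (<-≤-trans j<i′ i′≤l)
    k<l : k < l
    k<l = <-trans ≤-refl sk<l
    l≤M : l ≤ M
    l≤M = ≤-pred (≤-trans l<j′ j′≤)
    k≤M : k ≤ M
    k≤M = ≤-trans (<⇒≤ k<l) l≤M

apart-across : ∀ {G M u M′ u′} → Meet G M u M′ u′ → ∀ {i j i′ j′} → j ≤ M → j′ ≤ M′ → 1 ≤ i ⊎ 1 ≤ i′ →
               Apart G (Seg {G} u i j) (Seg {G} u′ i′ j′)
apart-across {G} S {i} {j} {i′} {j′} j≤ j′≤ pos x y (k , i≤k , k<j , refl) (l , i′≤l , l<j′ , refl) =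
  disj k< l< , λ e → nonzero pos (only k< l< e)
  where
  open Meet S
  k< = <-≤-trans k<j j≤
  l< = <-≤-trans l<j′ j′≤
  nonzero : 1 ≤ i ⊎ 1 ≤ i′ → ¬ (k ≡ 0 × l ≡ 0)
  nonzero (inj₁ p) (refl , _) with ≤-trans p i≤k
  ... | ()
  nonzero (inj₂ p) (_ , refl) with ≤-trans p i′≤l
  ... | ()

-- y, u₂, u₃ are the legs of a pyramid and Q is a connected set, reaching the leg y from h alone and
-- the leg u₂ from p alone, at its first two vertices.
module Attachment {G : Graph} (tf : ThetaFree G) (pf : PrismFree G) {a : V G} {N M₂ M₃ : ℕ} {y u₂ u₃ : ℕ → V G}
  (Y : Arm G a N y) (U₂ : Arm G a M₂ u₂) (U₃ : Arm G a M₃ u₃)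
  (S₂ : Meet G N y M₂ u₂) (S₃ : Meet G N y M₃ u₃) (S₂₃ : Meet G M₂ u₂ M₃ u₃)
  (Q′ : Pred G) (h p : V G)
  (conn : Walk G (With G h Q′) h p) (p~0 : E G p (u₂ 0)) (p~1 : E G p (u₂ 1))
  (offY : ∀ {v k} → With G h Q′ v → k ≤ N → v ≢ y k)
  (off₂ : ∀ {v k} → With G h Q′ v → k ≤ M₂ → v ≢ u₂ k)
  (off₃ : ∀ {v k} → With G h Q′ v → k ≤ M₃ → v ≢ u₃ k)
  (only₂ : ∀ {v k} → With G h Q′ v → k ≤ M₂ → E G v (u₂ k) → v ≡ p × k ≤ 1)
  (anti₃ : ∀ {v k} → With G h Q′ v → k ≤ M₃ → ¬ E G v (u₃ k))
  (antiY : ∀ {v k} → Q′ v → k ≤ N → ¬ E G v (y k))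
  (low : ∀ {k} → k ≤ N → E G h (y k) → suc k < N)
  where
  private
    Q : Pred G
    Q = With G h Q′
    module Y = Arm Y
    module U₂ = Arm U₂
    module U₃ = Arm U₃
    1≤M₂ = <⇒≤ U₂.long
    0<N = <-trans (s≤s z≤n) Y.long
    0<M₂ = <-trans (s≤s z≤n) U₂.long
    0<M₃ = <-trans (s≤s z≤n) U₃.long

    Q-u₃ : Apart G Q (Seg {G} u₃ 0 M₃)
    Q-u₃ x z Qx (k , _ , k< , refl) = off₃ Qx (<⇒≤ k<) , anti₃ Qx (<⇒≤ k<)

    Q-y : ∀ {X : Pred G} → (∀ {v} → X v → Q v) → ∀ {i j} → j ≤ N → (∀ k → i ≤ k → k < j → X h → ¬ E G h (y k)) →
          Apart G X (Seg {G} y i j)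
    Q-y {X} X⊆Q {i} {j} j≤N h≁y x z Xx (k , i≤k , k<j , refl) = offY (X⊆Q Xx) k≤N , x≁y (X⊆Q Xx)
      where
      k≤N = ≤-trans (<⇒≤ k<j) j≤N
      x≁y : Q x → ¬ E G x (y k)
      x≁y (inj₁ refl) = h≁y k i≤k k<j Xx
      x≁y (inj₂ Q′x) = antiY Q′x k≤N

  -- Theta with ends `y j` and `a`: up along `y`; down along `y` and across to `u₃`; through `Q` and
  -- up `u₂` from `u₂ 1`. The vertex `u₂ 0` is skipped because it is adjacent to `y 0` and `u₃ 0`,
  -- and `low` makes `y j` and `a` non-adjacent.
  uniqueNeighbour : ∀ j → j ≤ N → E G h (y j) → (∀ k → k ≤ N → E G h (y k) → k ≡ j) → ⊥
  uniqueNeighbour j j≤N h~j uniq =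
    thetaFromWalks tf (y j) a (top-apart Y j<N) (λ e → <-irrefl (top-near Y j≤N e) sj<N)
      X₁ X₂ X₃ w₁ w₂ w₃
      (Apart-sym {G} {X₂} {X₁} (Apart-∪ {G} {Seg {G} y 0 j} {Seg {G} u₃ 0 M₃} {X₁} (apart-within Y ≤-refl (n≤1+n N))
        (Apart-sym {G} {X₁} {Seg {G} u₃ 0 M₃} (apart-across S₃ ≤-refl ≤-refl (inj₁ (s≤s z≤n))))))
      (Apart-sym {G} {X₃} {X₁} (Apart-∪ {G} {Q} {Seg {G} u₂ 1 M₂} {X₁}
        (Q-y {Q} (λ q → q) ≤-refl (λ k j<k k<N _ e → <-irrefl (≡-sym (uniq k (<⇒≤ k<N) e)) j<k))
        (Apart-sym {G} {X₁} {Seg {G} u₂ 1 M₂} (apart-across S₂ ≤-refl ≤-refl (inj₁ (s≤s z≤n))))))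
      (Apart-∪ {G} {Seg {G} y 0 j} {Seg {G} u₃ 0 M₃} {X₃}
        (Apart-sym {G} {X₃} {Seg {G} y 0 j} (Apart-∪ {G} {Q} {Seg {G} u₂ 1 M₂} {Seg {G} y 0 j}
          (Q-y {Q} (λ q → q) j≤N (λ k _ k<j _ e → <-irrefl (uniq k (≤-trans (<⇒≤ k<j) j≤N) e) k<j))
          (Apart-sym {G} {Seg {G} y 0 j} {Seg {G} u₂ 1 M₂} (apart-across S₂ j≤N ≤-refl (inj₂ ≤-refl)))))
        (Apart-sym {G} {X₃} {Seg {G} u₃ 0 M₃} (Apart-∪ {G} {Q} {Seg {G} u₂ 1 M₂} {Seg {G} u₃ 0 M₃}
          Q-u₃ (apart-across S₂₃ ≤-refl ≤-refl (inj₁ ≤-refl)))))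
    where
    sj<N = low j≤N h~j
    j<N = <-trans ≤-refl sj<N
    X₁ X₂ X₃ : Pred G
    X₁ = Seg {G} y (suc j) N
    X₂ v = Seg {G} y 0 j v ⊎ Seg {G} u₃ 0 M₃ v
    X₃ v = Q v ⊎ Seg {G} u₂ 1 M₂ v
    w₁ : Walk G (EndsOr {G} (y j) a X₁) (y j) a
    w₁ = ascendTop Y j≤N mem (inj₂ (inj₁ refl))
      where
      mem : ∀ k → j ≤ k → k < N → EndsOr {G} (y j) a X₁ (y k)
      mem k j≤k k<N with m≤n⇒m<n∨m≡n j≤k
      ... | inj₁ j<k = inj₂ (inj₂ (k , j<k , k<N , refl))
      ... | inj₂ refl = inj₁ refl
    w₂ : Walk G (EndsOr {G} (y j) a X₂) (y j) a
    w₂ = joinʷ (reverseʷ (ascend Y z≤n j≤N mem)) (Meet.base S₃)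
           (ascendTop U₃ z≤n (λ k _ k< → inj₂ (inj₂ (inj₂ (k , z≤n , k< , refl)))) (inj₂ (inj₁ refl)))
      where
      mem : ∀ k → 0 ≤ k → k ≤ j → EndsOr {G} (y j) a X₂ (y k)
      mem k _ k≤j with m≤n⇒m<n∨m≡n k≤j
      ... | inj₁ k<j = inj₂ (inj₂ (inj₁ (k , z≤n , k<j , refl)))
      ... | inj₂ refl = inj₁ refl
    w₃ : Walk G (EndsOr {G} (y j) a X₃) (y j) a
    w₃ = step (inj₁ refl) (E-sym G h~j) (joinʷ (mapʷ (λ v q → inj₂ (inj₂ (inj₁ q))) conn) p~1
           (ascendTop U₂ 1≤M₂ (λ k 1≤k k< → inj₂ (inj₂ (inj₂ (k , 1≤k , k< , refl)))) (inj₂ (inj₁ refl))))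

  -- Theta with ends `h` and `a`: from `y l` upwards, from `y j` down and over `u₃`, and through
  -- `Q′` and `u₂`. Further neighbours of `h` on `y` do no harm since `h` is an end, and the gap
  -- between `j` and `l` keeps the two pieces of `y` apart.
  spreadNeighbours : ∀ j l → suc j < l → l ≤ N → E G h (y j) → E G h (y l) → ⊥
  spreadNeighbours j l sj<l l≤N h~j h~l =
    thetaFromWalks tf h a (λ eq → offY (inj₁ refl) ≤-refl (trans eq (≡-sym Y.top)))
      (λ e → <-asym (low ≤-refl (subst (E G h) (≡-sym Y.top) e)) ≤-refl)
      X₁ X₂ X₃ w₁ w₂ w₃
      (Apart-sym {G} {X₂} {X₁} (Apart-∪ {G} {Seg {G} y 0 (suc j)} {Seg {G} u₃ 0 M₃} {X₁} (apart-within Y sj<l (n≤1+n N))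
        (Apart-sym {G} {X₁} {Seg {G} u₃ 0 M₃} (apart-across S₃ ≤-refl ≤-refl (inj₁ 1≤l)))))
      (Apart-sym {G} {X₃} {X₁} (Apart-∪ {G} {Q′} {Seg {G} u₂ 1 M₂} {X₁}
        (Q-y {Q′} inj₂ ≤-refl (λ k _ k<N Q′h → antiY Q′h (<⇒≤ k<N)))
        (Apart-sym {G} {X₁} {Seg {G} u₂ 1 M₂} (apart-across S₂ ≤-refl ≤-refl (inj₂ ≤-refl)))))
      (Apart-∪ {G} {Seg {G} y 0 (suc j)} {Seg {G} u₃ 0 M₃} {X₃}
        (Apart-sym {G} {X₃} {Seg {G} y 0 (suc j)} (Apart-∪ {G} {Q′} {Seg {G} u₂ 1 M₂} {Seg {G} y 0 (suc j)}
          (Q-y {Q′} inj₂ j<N (λ k _ k≤j Q′h → antiY Q′h (≤-trans (<⇒≤ k≤j) j<N)))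
          (Apart-sym {G} {Seg {G} y 0 (suc j)} {Seg {G} u₂ 1 M₂} (apart-across S₂ j<N ≤-refl (inj₂ ≤-refl)))))
        (Apart-sym {G} {X₃} {Seg {G} u₃ 0 M₃} (Apart-∪ {G} {Q′} {Seg {G} u₂ 1 M₂} {Seg {G} u₃ 0 M₃}
          (λ x z q → Q-u₃ x z (inj₂ q)) (apart-across S₂₃ ≤-refl ≤-refl (inj₁ ≤-refl)))))
    where
    1≤l = ≤-trans (s≤s z≤n) sj<l
    j<N = <-≤-trans (<-trans ≤-refl sj<l) l≤N
    X₁ X₂ X₃ : Pred G
    X₁ = Seg {G} y l N
    X₂ v = Seg {G} y 0 (suc j) v ⊎ Seg {G} u₃ 0 M₃ v
    X₃ v = Q′ v ⊎ Seg {G} u₂ 1 M₂ v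
    ends : ∀ {X : Pred G} v → Q v → EndsOr {G} h a (λ v → Q′ v ⊎ X v) v
    ends v (inj₁ eq) = inj₁ eq
    ends v (inj₂ q) = inj₂ (inj₂ (inj₁ q))
    w₁ : Walk G (EndsOr {G} h a X₁) h a
    w₁ = step (inj₁ refl) h~l (ascendTop Y l≤N (λ k l≤k k<N → inj₂ (inj₂ (k , l≤k , k<N , refl))) (inj₂ (inj₁ refl)))
    w₂ : Walk G (EndsOr {G} h a X₂) h a
    w₂ = step (inj₁ refl) h~j (joinʷ
           (reverseʷ (ascend Y z≤n (<⇒≤ j<N) (λ k _ k≤j → inj₂ (inj₂ (inj₁ (k , z≤n , s≤s k≤j , refl))))))
           (Meet.base S₃)
           (ascendTop U₃ z≤n (λ k _ k< → inj₂ (inj₂ (inj₂ (k , z≤n , k< , refl)))) (inj₂ (inj₁ refl))))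
    w₃ : Walk G (EndsOr {G} h a X₃) h a
    w₃ = joinʷ (mapʷ (ends {Seg {G} u₂ 1 M₂}) conn) p~1
           (ascendTop U₂ 1≤M₂ (λ k 1≤k k< → inj₂ (inj₂ (inj₂ (k , 1≤k , k< , refl)))) (inj₂ (inj₁ refl)))

  -- Prism between the triangle `h`, `y j`, `y (suc j)` and the base triangle `u₂ 0`, `y 0`, `u₃ 0`.
  -- The paths run through `Q`, down `y`, and up `y` over `a` and down `u₃`; `1 ≤ j` keeps the
  -- triangles disjoint.
  highEdge : ∀ j → 1 ≤ j → suc j ≤ N → E G h (y j) → E G h (y (suc j)) →
             (∀ k → k ≤ N → E G h (y k) → j ≤ k × k ≤ suc j) → ⊥
  highEdge j 1≤j sj≤N h~j h~sj bounds =
    prismFromWalks pf {X₁ = X₁} {X₂} {X₃} h~j h~sj (Y.link sj≤N)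
      (E-sym G (Meet.base S₂)) (Meet.base S₂₃) (Meet.base S₃)
      (off₂ (inj₁ refl) z≤n) (λ eq → <-irrefl (≡-sym (Y.distinct j≤N z≤n eq)) 1≤j)
      (Meet.disj S₃ sj<N 0<M₃)
      w₁ w₂ w₃ L₁₂ L₁₃ L₂₃
    where
    j≤N = <⇒≤ sj≤N
    sj<N : suc j < N
    sj<N = <-trans ≤-refl (low sj≤N h~sj)
    X₁ X₂ X₃ : Pred G
    X₁ v = Q v ⊎ v ≡ u₂ 0
    X₂ = Seg {G} y 0 (suc j)
    X₃ v = Seg {G} y (suc j) (suc N) v ⊎ Seg {G} u₃ 0 M₃ v
    X₃a : X₃ a
    X₃a = inj₁ (N , sj≤N , ≤-refl , ≡-sym Y.top)
    w₁ : Walk G X₁ h (u₂ 0)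
    w₁ = joinʷ (mapʷ (λ _ → inj₁) conn) p~0 (stop (inj₂ refl))
    w₂ : Walk G X₂ (y j) (y 0)
    w₂ = reverseʷ (ascend Y z≤n j≤N (λ k _ k≤j → k , z≤n , s≤s k≤j , refl))
    w₃ : Walk G X₃ (y (suc j)) (u₃ 0)
    w₃ = ascendTop Y sj≤N (λ k le k< → inj₁ (k , le , m<n⇒m<1+n k< , refl)) X₃a
           ++ʷ reverseʷ (ascendTop U₃ z≤n (λ k _ k< → inj₂ (k , z≤n , k< , refl)) X₃a)
    L₁₂ : Linked {G} X₁ X₂ h (y j) (u₂ 0) (y 0)
    L₁₂ x z (inj₁ q) (k , _ , s≤s k≤j , refl) = offY q k≤N , adjacent q
      where
      k≤N = ≤-trans k≤j j≤N
      adjacent : Q x → E G x (y k) → (x ≡ h × y k ≡ y j) ⊎ (x ≡ u₂ 0 × y k ≡ y 0)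
      adjacent (inj₁ refl) e = inj₁ (refl , cong y (≤-antisym k≤j (proj₁ (bounds k k≤N e))))
      adjacent (inj₂ q′) e = ⊥-elim (antiY q′ k≤N e)
    L₁₂ x z (inj₂ refl) (k , _ , s≤s k≤j , refl) =
      (λ eq → Meet.disj S₂ k<N 0<M₂ (≡-sym eq)) ,
      λ e → inj₂ (refl , cong y (proj₁ (Meet.only S₂ k<N 0<M₂ (E-sym G e))))
      where k<N = ≤-<-trans k≤j sj≤N
    L₁₃ : Linked {G} X₁ X₃ h (y (suc j)) (u₂ 0) (u₃ 0)
    L₁₃ x z (inj₁ q) (inj₁ (k , sj≤k , s≤s k≤N , refl)) = offY q k≤N , adjacent q
      where
      adjacent : Q x → E G x (y k) → (x ≡ h × y k ≡ y (suc j)) ⊎ (x ≡ u₂ 0 × y k ≡ u₃ 0)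
      adjacent (inj₁ refl) e = inj₁ (refl , cong y (≤-antisym (proj₂ (bounds k k≤N e)) sj≤k))
      adjacent (inj₂ q′) e = ⊥-elim (antiY q′ k≤N e)
    L₁₃ x z (inj₁ q) (inj₂ (k , _ , k< , refl)) = off₃ q (<⇒≤ k<) , λ e → ⊥-elim (anti₃ q (<⇒≤ k<) e)
    L₁₃ x z (inj₂ refl) (inj₁ (k , sj≤k , s≤s k≤N , refl)) with m≤n⇒m<n∨m≡n k≤N
    ... | inj₁ k<N = (λ eq → Meet.disj S₂ k<N 0<M₂ (≡-sym eq)) , λ e → ⊥-elim (positive (proj₁ (Meet.only S₂ k<N 0<M₂ (E-sym G e))))
      where
      positive : k ≢ 0
      positive eq = <-irrefl (≡-sym eq) (≤-trans (s≤s z≤n) sj≤k)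
    -- Here the vertex of `y` is the apex, which `u₂ 0` does not see because the leg `u₂` has length
    -- at least two.
    ... | inj₂ refl = (λ eq → top-apart U₂ 0<M₂ (trans eq Y.top)) ,
      λ e → ⊥-elim (<-irrefl (top-near U₂ z≤n (subst (E G (u₂ 0)) Y.top e)) U₂.long)
    L₁₃ x z (inj₂ refl) (inj₂ (k , _ , k< , refl)) =
      Meet.disj S₂₃ 0<M₂ k< , λ e → inj₂ (refl , cong u₃ (proj₂ (Meet.only S₂₃ 0<M₂ k< e)))
    L₂₃ : Linked {G} X₂ X₃ (y j) (y (suc j)) (y 0) (u₃ 0)
    L₂₃ x z (k , _ , s≤s k≤j , refl) (inj₁ (l , sj≤l , s≤s l≤N , refl)) =
      (λ eq → <-irrefl (Y.distinct k≤N l≤N eq) k<l) , λ e → inj₁ (adjacent (Y.near k≤N l≤N e))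
      where
      k≤N = ≤-trans k≤j j≤N
      k<l = ≤-trans (s≤s k≤j) sj≤l
      adjacent : k ≡ suc l ⊎ l ≡ suc k → y k ≡ y j × y l ≡ y (suc j)
      adjacent (inj₁ refl) = ⊥-elim (<-asym k<l ≤-refl)
      adjacent (inj₂ refl) with ≤-antisym k≤j (≤-pred sj≤l)
      ... | refl = refl , refl
    L₂₃ x z (k , _ , s≤s k≤j , refl) (inj₂ (l , _ , l< , refl)) =
      Meet.disj S₃ k<N l< , λ e → let (p , q) = Meet.only S₃ k<N l< e in inj₂ (cong y p , cong u₃ q)
      where k<N = ≤-<-trans k≤j sj≤N

  consecutive : ∀ j l → suc j ≡ l → l ≤ N → E G h (y j) → E G h (y l) →
    (∀ i → E G h (y i) → j ≤ i) → (∀ i → i ≤ N → E G h (y i) → i ≤ l) →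
    E G h (y 0) × E G h (y 1) × (∀ i → i ≤ N → E G h (y i) → i ≤ 1)
  consecutive zero _ refl _ h~j h~l _ upper = h~j , h~l , upper
  consecutive (suc j) _ refl l≤N h~j h~l lower upper =
    ⊥-elim (highEdge (suc j) (s≤s z≤n) l≤N h~j h~l (λ i i≤N e → lower i e , upper i i≤N e))

  -- Compare the lowest and the highest neighbour of `h` on `y`: equal ones or ones with a gap give
  -- a theta, consecutive ones give a prism unless they are the first two vertices.
  firstEdge : ∀ {k} → k ≤ N → E G h (y k) → E G h (y 0) × E G h (y 1) × (∀ i → i ≤ N → E G h (y i) → i ≤ 1)
  firstEdge {k} k≤N h~k with least (λ i → E? G h (y i)) k h~k
  ... | j , j≤k , h~j , min with greatest (λ i → E? G h (y i)) N (≤-trans j≤k k≤N) h~j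
  ...   | l , j≤l , l≤N , h~l , max = conclude (m≤n⇒m<n∨m≡n j≤l)
    where
    lower : ∀ i → E G h (y i) → j ≤ i
    lower i e = ≮⇒≥ (λ i<j → min i i<j e)
    upper : ∀ i → i ≤ N → E G h (y i) → i ≤ l
    upper i i≤N e = ≮⇒≥ (λ l<i → max i l<i i≤N e)
    conclude : j < l ⊎ j ≡ l → E G h (y 0) × E G h (y 1) × (∀ i → i ≤ N → E G h (y i) → i ≤ 1)
    conclude (inj₂ refl) = ⊥-elim (uniqueNeighbour j l≤N h~j (λ i i≤N e → ≤-antisym (upper i i≤N e) (lower i e)))
    conclude (inj₁ j<l) with m≤n⇒m<n∨m≡n j<l
    ... | inj₁ sj<l = ⊥-elim (spreadNeighbours j l sj<l l≤N h~j h~l)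
    conclude (inj₁ j<l) | inj₂ sj≡l = consecutive j l sj≡l l≤N h~j h~l lower upper

  -- The three paths of the prism are the walk from `h` to `p` in `Q`, the base edge from `y 0` to
  -- `u₂ 0`, and the route from `y 1` over `a` to `u₂ 1`.
  noDetour : h ≢ p → ∀ {k} → k ≤ N → ¬ E G h (y k)
  noDetour h≢p k≤N h~k with firstEdge k≤N h~k
  ... | h~0 , h~1 , upper =
    prismFromWalks pf {X₁ = Q} {X₂} {X₃} h~0 h~1 (Y.link 0<N) p~0 p~1 (U₂.link 0<M₂)
      h≢p (Meet.disj S₂ 0<N 0<M₂) (Meet.disj S₂ Y.long U₂.long)
      conn (step (inj₁ refl) (Meet.base S₂) (stop (inj₂ refl)))
      (ascendTop Y (<⇒≤ Y.long) (λ i 1≤i i<N → inj₁ (i , 1≤i , m<n⇒m<1+n i<N , refl)) X₃a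
        ++ʷ reverseʷ (ascendTop U₂ 1≤M₂ (λ i 1≤i i< → inj₂ (i , 1≤i , i< , refl)) X₃a))
      L₁₂ L₁₃ L₂₃
    where
    X₂ X₃ : Pred G
    X₂ v = v ≡ y 0 ⊎ v ≡ u₂ 0
    X₃ v = Seg {G} y 1 (suc N) v ⊎ Seg {G} u₂ 1 M₂ v
    X₃a : X₃ a
    X₃a = inj₁ (N , <⇒≤ Y.long , ≤-refl , ≡-sym Y.top)
    L₁₂ : Linked {G} Q X₂ h (y 0) p (u₂ 0)
    L₁₂ x z q (inj₁ refl) = offY q z≤n , adjacent q
      where
      adjacent : Q x → E G x (y 0) → (x ≡ h × y 0 ≡ y 0) ⊎ (x ≡ p × y 0 ≡ u₂ 0)
      adjacent (inj₁ eq) e = inj₁ (eq , refl)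
      adjacent (inj₂ q′) e = ⊥-elim (antiY q′ z≤n e)
    L₁₂ x z q (inj₂ refl) = off₂ q z≤n , λ e → inj₂ (proj₁ (only₂ q z≤n e) , refl)
    L₁₃ : Linked {G} Q X₃ h (y 1) p (u₂ 1)
    L₁₃ x z q (inj₁ (i , 1≤i , s≤s i≤N , refl)) = offY q i≤N , adjacent q
      where
      adjacent : Q x → E G x (y i) → (x ≡ h × y i ≡ y 1) ⊎ (x ≡ p × y i ≡ u₂ 1)
      adjacent (inj₁ refl) e = inj₁ (refl , cong y (≤-antisym (upper i i≤N e) 1≤i))
      adjacent (inj₂ q′) e = ⊥-elim (antiY q′ i≤N e)
    L₁₃ x z q (inj₂ (i , 1≤i , i< , refl)) =
      off₂ q (<⇒≤ i<) , λ e → let (x≡p , i≤1) = only₂ q (<⇒≤ i<) e in inj₂ (x≡p , cong u₂ (≤-antisym i≤1 1≤i))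
    L₂₃ : Linked {G} X₂ X₃ (y 0) (y 1) (u₂ 0) (u₂ 1)
    L₂₃ x z (inj₁ refl) (inj₁ (i , 1≤i , s≤s i≤N , refl)) =
      (λ eq → <-irrefl (Y.distinct z≤n i≤N eq) 1≤i) , λ e → inj₁ (refl , adjacent (Y.near z≤n i≤N e))
      where
      adjacent : 0 ≡ suc i ⊎ i ≡ 1 → y i ≡ y 1
      adjacent (inj₁ ())
      adjacent (inj₂ refl) = refl
    L₂₃ x z (inj₁ refl) (inj₂ (i , 1≤i , i< , refl)) =
      Meet.disj S₂ 0<N i< , λ e → ⊥-elim (<-irrefl (≡-sym (proj₂ (Meet.only S₂ 0<N i< e))) 1≤i)
    L₂₃ x z (inj₂ refl) (inj₁ (i , 1≤i , s≤s i≤N , refl)) with m≤n⇒m<n∨m≡n i≤N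
    ... | inj₁ i<N = (λ eq → Meet.disj S₂ i<N 0<M₂ (≡-sym eq)) ,
      λ e → ⊥-elim (<-irrefl (≡-sym (proj₁ (Meet.only S₂ i<N 0<M₂ (E-sym G e)))) 1≤i)
    ... | inj₂ refl = (λ eq → top-apart U₂ 0<M₂ (trans eq Y.top)) ,
      λ e → ⊥-elim (<-irrefl (top-near U₂ z≤n (subst (E G (u₂ 0)) Y.top e)) U₂.long)
    L₂₃ x z (inj₂ refl) (inj₂ (i , 1≤i , i< , refl)) =
      (λ eq → <-irrefl (U₂.distinct z≤n (<⇒≤ i<) eq) 1≤i) , λ e → inj₂ (refl , adjacent (U₂.near z≤n (<⇒≤ i<) e))
      where
      adjacent : 0 ≡ suc i ⊎ i ≡ 1 → u₂ i ≡ u₂ 1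
      adjacent (inj₁ ())
      adjacent (inj₂ refl) = refl

-- Replacing a leg next to a jewel

-- The old leg `u₁` and the new leg `y` may share vertices and have edges between them, so no `Meet`
-- relates them. Contact between them is restricted only near the apex, by `low₁`.
module Rerouting {G : Graph} (tf : ThetaFree G) (pf : PrismFree G) {a : V G}
  {N M₁ M₂ M₃ : ℕ} {y u₁ u₂ u₃ : ℕ → V G}
  (Y : Arm G a N y) (U₁ : Arm G a M₁ u₁) (U₂ : Arm G a M₂ u₂) (U₃ : Arm G a M₃ u₃)
  (S₂ : Meet G N y M₂ u₂) (S₃ : Meet G N y M₃ u₃) (S₂₃ : Meet G M₂ u₂ M₃ u₃)
  (S₁₂ : Meet G M₁ u₁ M₂ u₂) (S₁₃ : Meet G M₁ u₁ M₃ u₃)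
  (p : V G) (p~1 : E G p (u₁ 1)) (p~0′ : E G p (u₂ 0)) (p~1′ : E G p (u₂ 1))
  (offY : ∀ {k} → k ≤ N → p ≢ y k) (off₁ : ∀ {k} → k ≤ M₁ → p ≢ u₁ k)
  (off₂ : ∀ {k} → k ≤ M₂ → p ≢ u₂ k) (off₃ : ∀ {k} → k ≤ M₃ → p ≢ u₃ k)
  (only₂ : ∀ {k} → k ≤ M₂ → E G p (u₂ k) → k ≤ 1) (anti₃ : ∀ {k} → k ≤ M₃ → ¬ E G p (u₃ k))
  (lowP : ∀ {k} → k ≤ N → E G p (y k) → suc k < N)
  (low₁ : ∀ {l k} → l < M₁ → (∀ {k} → k ≤ N → u₁ l ≢ y k) → k ≤ N → E G (u₁ l) (y k) → suc k < N)
  where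
  private
    module Y = Arm Y
    module U₁ = Arm U₁

    Touches : V G → Set
    Touches x = ∃[ k ] (k ≤ N × E G x (y k))

    touches? : ∀ x → Dec (Touches x)
    touches? x with anyUpTo? (λ k → E? G x (y k)) (suc N)
    ... | yes (k , s≤s k≤N , e) = yes (k , k≤N , e)
    ... | no none = no λ { (k , k≤N , e) → none (k , s≤s k≤N , e) }

    atTop : ∀ {x u M} → Arm G a M u → ∀ {l} → l ≡ M → E G x (u l) → E G x (y N)
    atTop {x} U refl e = subst (E G x) (trans (Arm.top U) (≡-sym Y.top)) e

  touching : Touches p → E G p (y 0) × E G p (y 1)
  touching (k , k≤N , e) = let (e₀ , e₁ , _) = D.firstEdge k≤N e in e₀ , e₁
    where
    Q : Pred G
    Q = With G p (λ _ → ⊥)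
    offY′ : ∀ {v k} → Q v → k ≤ N → v ≢ y k
    offY′ (inj₁ refl) = offY
    off₂′ : ∀ {v k} → Q v → k ≤ M₂ → v ≢ u₂ k
    off₂′ (inj₁ refl) = off₂
    off₃′ : ∀ {v k} → Q v → k ≤ M₃ → v ≢ u₃ k
    off₃′ (inj₁ refl) = off₃
    only₂′ : ∀ {v k} → Q v → k ≤ M₂ → E G v (u₂ k) → v ≡ p × k ≤ 1
    only₂′ (inj₁ refl) k≤ e = refl , only₂ k≤ e
    anti₃′ : ∀ {v k} → Q v → k ≤ M₃ → ¬ E G v (u₃ k)
    anti₃′ (inj₁ refl) = anti₃
    antiY : ∀ {v k} → ⊥ → k ≤ N → ¬ E G v (y k)
    antiY ()
    module D = Attachment tf pf Y U₂ U₃ S₂ S₃ S₂₃ (λ _ → ⊥) p p (stop (inj₁ refl)) p~0′ p~1′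
      offY′ off₂′ off₃′ only₂′ anti₃′ antiY lowP

  -- The connected set consists of `p` and `u₁ 1`, ..., `u₁ i`. It starts at `u₁ 1`, a neighbour of
  -- `p`, because `u₁ 0` is adjacent to the base vertices of the other legs.
  detour : ¬ Touches p → ∀ i → 1 ≤ i → i < M₁ → Touches (u₁ i) → (∀ l → 1 ≤ l → l < i → ¬ Touches (u₁ l)) → ⊥
  detour p≁y i 1≤i i<M₁ (k , k≤N , e) min = D.noDetour (λ eq → off₁ (<⇒≤ i<M₁) (≡-sym eq)) k≤N e
    where
    Q′ Q : Pred G
    Q′ v = v ≡ p ⊎ Seg {G} u₁ 1 i v
    Q = With G (u₁ i) Q′
    -- If `u₁ l` lay on `y`, its predecessor (`p` when `l` is 1) would already touch `y`.
    notOnY : ∀ l → 1 ≤ l → l ≤ i → ∀ {k} → k ≤ N → u₁ l ≢ y k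
    notOnY (suc zero) _ _ k≤N eq = p≁y (_ , k≤N , subst (E G p) eq p~1)
    notOnY (suc (suc l)) _ l≤i k≤N eq =
      min (suc l) (s≤s z≤n) l≤i (_ , k≤N , subst (E G (u₁ (suc l))) eq (U₁.link (<-trans l≤i i<M₁)))
    notTop : ∀ l → 1 ≤ l → l ≤ i → ¬ E G (u₁ l) (y N)
    notTop l 1≤l l≤i e with m≤n⇒m<n∨m≡n l≤i
    ... | inj₁ l<i = min l 1≤l l<i (N , ≤-refl , e)
    ... | inj₂ refl = <-asym (low₁ i<M₁ (notOnY i 1≤i ≤-refl) ≤-refl e) ≤-refl
    view : ∀ {v} → Q v → v ≡ p ⊎ ∃[ l ] (1 ≤ l × l ≤ i × v ≡ u₁ l)
    view (inj₁ eq) = inj₂ (i , 1≤i , ≤-refl , eq)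
    view (inj₂ (inj₁ eq)) = inj₁ eq
    view (inj₂ (inj₂ (l , 1≤l , l<i , eq))) = inj₂ (l , 1≤l , <⇒≤ l<i , eq)
    offArm : ∀ {M u v k} → Arm G a M u → Meet G M₁ u₁ M u → (p ≢ u k) → Q v → k ≤ M → v ≢ u k
    offArm {M} {u} {v} {k} U S p≢ q k≤M with view q
    ... | inj₁ refl = p≢
    ... | inj₂ (l , _ , l≤i , refl) with m≤n⇒m<n∨m≡n k≤M
    ...   | inj₁ k<M = Meet.disj S (≤-<-trans l≤i i<M₁) k<M
    ...   | inj₂ refl = λ eq → top-apart U₁ (≤-<-trans l≤i i<M₁) (trans eq (Arm.top U))
    antiArm : ∀ {M u k l} → Arm G a M u → Meet G M₁ u₁ M u → 1 ≤ l → l ≤ i → k ≤ M → ¬ E G (u₁ l) (u k)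
    antiArm {M} {u} {k} {l} U S 1≤l l≤i k≤M e with m≤n⇒m<n∨m≡n k≤M
    ... | inj₁ k<M = <-irrefl (≡-sym (proj₁ (Meet.only S (≤-<-trans l≤i i<M₁) k<M e))) 1≤l
    ... | inj₂ eq = notTop l 1≤l l≤i (atTop U eq e)
    only : ∀ {v k} → Q v → k ≤ M₂ → E G v (u₂ k) → v ≡ p × k ≤ 1
    only q k≤ e with view q
    ... | inj₁ refl = refl , only₂ k≤ e
    ... | inj₂ (l , 1≤l , l≤i , refl) = ⊥-elim (antiArm U₂ S₁₂ 1≤l l≤i k≤ e)
    anti : ∀ {v k} → Q v → k ≤ M₃ → ¬ E G v (u₃ k)
    anti q k≤ e with view q
    ... | inj₁ refl = anti₃ k≤ e
    ... | inj₂ (l , 1≤l , l≤i , refl) = antiArm U₃ S₁₃ 1≤l l≤i k≤ e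
    off : ∀ {v k} → Q v → k ≤ N → v ≢ y k
    off q k≤N with view q
    ... | inj₁ refl = offY k≤N
    ... | inj₂ (l , 1≤l , l≤i , refl) = notOnY l 1≤l l≤i k≤N
    conn : Walk G Q (u₁ i) p
    conn = joinʷ (reverseʷ (ascend U₁ 1≤i (<⇒≤ i<M₁) mem)) (E-sym G p~1) (stop (inj₂ (inj₁ refl)))
      where
      mem : ∀ l → 1 ≤ l → l ≤ i → Q (u₁ l)
      mem l 1≤l l≤i with m≤n⇒m<n∨m≡n l≤i
      ... | inj₁ l<i = inj₂ (inj₂ (l , 1≤l , l<i , refl))
      ... | inj₂ refl = inj₁ refl
    offTwo : ∀ {v k} → Q v → k ≤ M₂ → v ≢ u₂ k
    offTwo q k≤ = offArm U₂ S₁₂ (off₂ k≤) q k≤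
    offThree : ∀ {v k} → Q v → k ≤ M₃ → v ≢ u₃ k
    offThree q k≤ = offArm U₃ S₁₃ (off₃ k≤) q k≤
    antiY : ∀ {v k} → Q′ v → k ≤ N → ¬ E G v (y k)
    antiY (inj₁ refl) k≤N e = p≁y (_ , k≤N , e)
    antiY (inj₂ (l , 1≤l , l<i , refl)) k≤N e = min l 1≤l l<i (_ , k≤N , e)
    low : ∀ {k} → k ≤ N → E G (u₁ i) (y k) → suc k < N
    low = low₁ i<M₁ (notOnY i 1≤i ≤-refl)
    module D = Attachment tf pf Y U₂ U₃ S₂ S₃ S₂₃ Q′ (u₁ i) p conn p~0′ p~1′
      off offTwo offThree only anti antiY low

  attached : E G p (y 0) × E G p (y 1)
  attached with touches? p
  ... | yes t = touching t
  ... | no p≁y = ⊥-elim (search M₁ ≤-refl U₁.long U₁.top)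
    where
    -- A touching vertex exists: the vertex of `u₁` before the apex is adjacent to `a`, which is
    -- `y N`. Indices are shifted by one so that `u₁ 0` is never tested.
    search : ∀ M → M ≤ M₁ → 2 ≤ M → u₁ M ≡ a → ⊥
    search (suc (suc m)) le _ top with least (λ k → touches? (u₁ (suc k))) m
                                         (N , ≤-refl , subst (E G (u₁ (suc m))) (trans top (≡-sym Y.top)) (U₁.link le))
    ... | i , i≤m , t , min = detour p≁y (suc i) (s≤s z≤n) (<-≤-trans (s≤s (s≤s i≤m)) le) t
            (λ { (suc l) _ (s≤s l<i) t′ → min l l<i t′ })
    search (suc zero) _ (s≤s ()) _

-- Strip structures

-- Paths of a pyramid start at the apex, arms at the base. Truncated subtraction makes every index
-- beyond the length yield the start of the path.
reversed : ∀ {G} → Path G → ℕ → V G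
reversed P k = vx P (fromℕ< (s≤s (m∸n≤m (len P) k)))

module _ {G : Graph} (P : Path G) where
  private
    L = len P
    u = reversed P

    index : ∀ k → toℕ (fromℕ< (s≤s (m∸n≤m L k))) ≡ L ∸ k
    index k = toℕ-fromℕ< (s≤s (m∸n≤m L k))

    ∸-suc-inverse : ∀ {i j} → i ≤ L → j ≤ L → L ∸ i ≡ suc (L ∸ j) → j ≡ suc i
    ∸-suc-inverse {i} {j} i≤L j≤L eq = +-cancelˡ-≡ (L ∸ j) j (suc i)
      (trans (m∸n+n≡m j≤L) (trans (≡-sym (m∸n+n≡m i≤L)) (trans (cong (_+ i) eq) (≡-sym (+-suc (L ∸ j) i)))))

    ∸-step : ∀ {i} → i < L → L ∸ i ≡ suc (L ∸ suc i)
    ∸-step {i} i<L = +-cancelʳ-≡ i (L ∸ i) (suc (L ∸ suc i))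
      (trans (m∸n+n≡m (<⇒≤ i<L)) (trans (≡-sym (m∸n+n≡m i<L)) (+-suc (L ∸ suc i) i)))

  reversed-vx : ∀ i → vx P i ≡ reversed P (L ∸ toℕ i)
  reversed-vx i = cong (vx P) (toℕ-injective (≡-sym (trans (index (L ∸ toℕ i)) (m∸[m∸n]≡n (≤-pred (toℕ<n i))))))

  reversed-onPath : ∀ k → onPath P (reversed P k)
  reversed-onPath k = _ , refl

  reversed-0 : reversed P 0 ≡ finish P
  reversed-0 = cong (vx P) (toℕ-injective (trans (index 0) (≡-sym (toℕ-fromℕ L))))

  reversed-len : reversed P L ≡ start P
  reversed-len = cong (vx P) (toℕ-injective (trans (index L) (n∸n≡0 L)))

  reversed-injective : ∀ {i j} → i ≤ L → j ≤ L → reversed P i ≡ reversed P j → i ≡ j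
  reversed-injective {i} {j} i≤L j≤L eq =
    ∸-cancelˡ-≡ i≤L j≤L (trans (≡-sym (index i)) (trans (cong toℕ (inj P _ _ eq)) (index j)))

  reversed-arm : 2 ≤ L → Arm G (start P) L (reversed P)
  reversed-arm 2≤L = record
    { top = reversed-len ; long = 2≤L ; distinct = reversed-injective
    ; near = λ {i} {j} i≤L j≤L e →
        [ (λ eq → inj₂ (∸-suc-inverse i≤L j≤L (trans (≡-sym (index i)) (trans eq (cong suc (index j))))))
        , (λ eq → inj₁ (∸-suc-inverse j≤L i≤L (trans (≡-sym (index j)) (trans eq (cong suc (index i)))))) ]′
        (proj₁ (adjIff P _ _) e)
    ; link = λ {i} i<L → proj₂ (adjIff P _ _)
        (inj₁ (trans (index i) (trans (∸-step i<L) (cong suc (≡-sym (index (suc i))))))) }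

position : ∀ {n} (i : Fin (suc n)) → i ≡ zero ⊎ i ≡ fromℕ n ⊎ (0 < toℕ i × toℕ i < n)
position zero = inj₁ refl
position {n} (suc i) with m≤n⇒m<n∨m≡n (≤-pred (toℕ<n (suc i)))
... | inj₁ i<n = inj₂ (inj₂ (s≤s z≤n , i<n))
... | inj₂ eq = inj₂ (inj₁ (toℕ-injective (trans eq (≡-sym (toℕ-fromℕ n)))))

sameEdge? : ∀ {n} (x y u w : Fin n) → Dec (SameEdge x y u w)
sameEdge? x y u w = ((x Fin.≟ u) ×-dec (y Fin.≟ w)) ⊎-dec ((x Fin.≟ w) ×-dec (y Fin.≟ u))

module _ {G T : Graph} (ζ : ZetaMap G T) {u w : V T} where

  -- The interior of a long rung avoids both end sets and each of its ends lies in only one of them,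
  -- which leaves one candidate index per end set.
  rung-ends : ∀ {R} → IsRung ζ u w R → len R ≢ 0 →
    ∃[ i ] (∀ j → inEV ζ u w u (vx R j) → j ≡ i) × ∃[ i ] (∀ j → inEV ζ u w w (vx R j) → j ≡ i)
  rung-ends (_ , inj₁ (len0 , _)) len≢0 = ⊥-elim (len≢0 len0)
  rung-ends {R} (_ , inj₂ (inj₁ (_ , ¬ws , _ , ¬uf) , int)) _ = zero , only-u , fromℕ (len R) , only-w
    where
    only-u : ∀ j → inEV ζ u w u (vx R j) → j ≡ zero
    only-u j ∈u with position j
    ... | inj₁ eq = eq
    ... | inj₂ (inj₁ refl) = ⊥-elim (¬uf ∈u)
    ... | inj₂ (inj₂ (l , r)) = ⊥-elim (proj₁ (proj₂ (int _ (j , l , r , refl))) ∈u)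
    only-w : ∀ j → inEV ζ u w w (vx R j) → j ≡ fromℕ (len R)
    only-w j ∈w with position j
    ... | inj₁ refl = ⊥-elim (¬ws ∈w)
    ... | inj₂ (inj₁ eq) = eq
    ... | inj₂ (inj₂ (l , r)) = ⊥-elim (proj₂ (proj₂ (int _ (j , l , r , refl))) ∈w)
  rung-ends {R} (_ , inj₂ (inj₂ (_ , ¬us , _ , ¬wf) , int)) _ = fromℕ (len R) , only-u , zero , only-w
    where
    only-u : ∀ j → inEV ζ u w u (vx R j) → j ≡ fromℕ (len R)
    only-u j ∈u with position j
    ... | inj₁ refl = ⊥-elim (¬us ∈u)
    ... | inj₂ (inj₁ eq) = eq
    ... | inj₂ (inj₂ (l , r)) = ⊥-elim (proj₁ (proj₂ (int _ (j , l , r , refl))) ∈u)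
    only-w : ∀ j → inEV ζ u w w (vx R j) → j ≡ zero
    only-w j ∈w with position j
    ... | inj₁ eq = eq
    ... | inj₂ (inj₁ refl) = ⊥-elim (¬wf ∈w)
    ... | inj₂ (inj₂ (l , r)) = ⊥-elim (proj₂ (proj₂ (int _ (j , l , r , refl))) ∈w)

module Strip {G T : Graph} (ζ : ZetaMap G T) {a : V G} (S : IsStrip ζ a) (rich : Rich ζ a)
  {v : V T} (¬leaf : ¬ Leaf T v) where
  open IsStrip S

  Off Outside : Pred G
  Off x = ∃[ c ] ∃[ d ] (E T c d × c ≢ v × d ≢ v × inE ζ c d x)
  Outside x = x ≡ a ⊎ Off x

  ¬SameEdge-off : ∀ {w c d} → c ≢ v → d ≢ v → ¬ SameEdge v w c d
  ¬SameEdge-off c≢v d≢v (inj₁ (eq , _)) = c≢v (≡-sym eq)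
  ¬SameEdge-off c≢v d≢v (inj₂ (eq , _)) = d≢v (≡-sym eq)

  off-notIn : ∀ {w x} → E T v w → Off x → ¬ inE ζ v w x
  off-notIn vw (c , d , cd , c≢v , d≢v , ∈cd) ∈vw = s1EE _ _ _ _ vw cd (¬SameEdge-off c≢v d≢v) _ ∈vw ∈cd

  leafEdge : ∀ {w x} → E T v w → inE ζ v w x → E G x a → Leaf T w × inEV ζ v w w x
  leafEdge {w} {x} vw x∈ x~a with s8only x (inj₂ (v , w , vw , x∈)) (E-sym G x~a)
  ... | l , w′ , leaf , lw′ , ∈l with sameEdge? v w l w′
  ...   | no ne = ⊥-elim (s1EE _ _ _ _ vw lw′ ne x x∈ (s3sub _ _ lw′ _ _ ∈l))
  ...   | yes (inj₁ (refl , refl)) = ⊥-elim (¬leaf leaf)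
  ...   | yes (inj₂ (refl , refl)) = leaf , trans (symEV v w vw w x) ∈l

  through : ∀ {w x z} → E T v w → inE ζ v w x → (c d : V T) → E T c d → c ≢ v → d ≢ v → inE ζ c d z → E G x z →
            inEV ζ v w w x × inEV ζ c d w z
  through {w} vw x∈ c d cd c≢v d≢v z∈ x~z with s4only _ _ _ _ vw cd (¬SameEdge-off c≢v d≢v) _ _ x∈ z∈ x~z
  ... | z′ , ∈x , ∈z with proj₁ (s3ne v w vw z′) (_ , ∈x)
  ...   | inj₂ refl = ∈x , ∈z
  ...   | inj₁ refl with proj₁ (s3ne c d cd v) (_ , ∈z)
  ...     | inj₁ eq = ⊥-elim (c≢v (≡-sym eq))
  ...     | inj₂ eq = ⊥-elim (d≢v (≡-sym eq))

  exit : ∀ {w x z} → E T v w → inE ζ v w x → Outside z → E G x z → inEV ζ v w w x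
  exit vw x∈ (inj₁ refl) e = proj₂ (leafEdge vw x∈ e)
  exit vw x∈ (inj₂ (c , d , cd , c≢v , d≢v , z∈)) e = proj₁ (through vw x∈ c d cd c≢v d≢v z∈ e)

  -- By (S4), or (S8) if `w` is a leaf, adjacency to the outside depends only on membership in
  -- `ζ(vw,w)`. This is what allows one rung to be exchanged for another.
  transfer : ∀ {w x x′ z} → E T v w → inEV ζ v w w x → inEV ζ v w w x′ → Outside z → E G x z → E G x′ z
  transfer {w} vw ∈x ∈x′ (inj₁ refl) e =
    E-sym G (s8comp w v (proj₁ (leafEdge vw (s3sub _ _ vw _ _ ∈x) e)) (E-sym T vw) _ (trans (≡-sym (symEV v w vw w _)) ∈x′))
  transfer vw ∈x ∈x′ (inj₂ (c , d , cd , c≢v , d≢v , z∈)) e =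
    s4comp _ _ _ _ vw cd (¬SameEdge-off c≢v d≢v) _ _ _ ∈x′ (proj₂ (through vw (s3sub _ _ vw _ _ ∈x) c d cd c≢v d≢v z∈ e))

  leafEnd-unique : ∀ {w x x′} → E T v w → inEV ζ v w w x → inEV ζ v w w x′ → E G x a → x ≡ x′
  leafEnd-unique {w} vw ∈x ∈x′ e
    with proj₂ rich w v (proj₁ (leafEdge vw (s3sub _ _ vw _ _ ∈x) e)) (E-sym T vw)
  ... | _ , _ , uniq = trans (uniq _ (trans (≡-sym (symEV v w vw w _)) ∈x))
                         (≡-sym (uniq _ (trans (≡-sym (symEV v w vw w _)) ∈x′)))

  -- The part of a ζ-pyramid leg that survives forgetting its tree path: only the strip at `v` is
  -- described in detail. `deep` records that the rung there is long.
  record StripArm (w : V T) (M : ℕ) (u : ℕ → V G) : Set where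
    field
      arm    : Arm G a M u
      root   : inEV ζ v w v (u 0)
      inside : ∀ {k} → k < M → inE ζ v w (u k) ⊎ Off (u k)
      uniqV  : ∀ {k l} → k < M → l < M → inEV ζ v w v (u k) → inEV ζ v w v (u l) → k ≡ l
      uniqW  : ∀ {k l} → k < M → l < M → inEV ζ v w w (u k) → inEV ζ v w w (u l) → k ≡ l
      deep   : ∃[ k ] (1 ≤ k × k < M × inE ζ v w (u k))
    open Arm arm public

  -- The rung of the arm in ζ(vw) is u 0, …, u m.
  record Split (w : V T) (M : ℕ) (u : ℕ → V G) : Set where
    field
      m       : ℕ
      1≤m     : 1 ≤ m
      m<M     : m < M
      initial : ∀ {k} → k ≤ m → inE ζ v w (u k)
      final   : ∀ {k} → m < k → k ≤ M → Outside (u k)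
      exitEnd : inEV ζ v w w (u m)

  split : ∀ {w M u} → E T v w → StripArm w M u → Split w M u
  split {w} {zero} vw A with StripArm.long A
  ... | ()
  split {w} {suc M′} {u} vw A with StripArm.deep A
  ... | k , 1≤k , s≤s k≤M′ , k∈ with greatest (λ k → zE ζ v w (u k) Bool.≟ true) M′ k≤M′ k∈
  ...   | m , k≤m , m≤M′ , m∈ , max = record
    { m = m ; 1≤m = ≤-trans 1≤k k≤m ; m<M = s≤s m≤M′ ; initial = λ {k} → initial k
    ; final = final ; exitEnd = exitEnd }
    where
    open StripArm A
    final : ∀ {k} → m < k → k ≤ suc M′ → Outside (u k)
    final m<k k≤ with m≤n⇒m<n∨m≡n k≤
    ... | inj₂ refl = inj₁ top
    ... | inj₁ (s≤s k≤M′) with inside (s≤s k≤M′)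
    ...   | inj₁ ∈ = ⊥-elim (max _ m<k k≤M′ ∈)
    ...   | inj₂ off = inj₂ off
    exitEnd : inEV ζ v w w (u m)
    exitEnd = exit vw m∈ (final ≤-refl (s≤s m≤M′)) (link (s≤s m≤M′))
    initial : ∀ k → k ≤ m → inE ζ v w (u k)
    initial zero _ = s3sub _ _ vw _ _ root
    initial (suc k) k<m with inside {suc k} (s≤s (≤-trans k<m m≤M′))
    ... | inj₁ ∈ = ∈
    -- Leaving the strip before `m` would produce a second vertex of `ζ(vw,w)` besides `u m`.
    ... | inj₂ off = ⊥-elim (<-irrefl (uniqW k<M (s≤s m≤M′) (exit vw (initial k (<⇒≤ k<m)) (inj₂ off) (link k<M)) exitEnd) k<m)
      where k<M = s≤s (≤-trans (<⇒≤ k<m) m≤M′)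

  leg : ∀ {w} → ZPyramid ζ a v w → Fin 3 → ℕ → V G
  leg Z i = reversed (Pyramid.P (ZPyramid.pyr Z) i)

  legLen : ∀ {w} → ZPyramid ζ a v w → Fin 3 → ℕ
  legLen Z i = len (Pyramid.P (ZPyramid.pyr Z) i)

  module _ {w : Fin 3 → V T} (Z : ZPyramid ζ a v w) (vw : ∀ i → E T v (w i)) where
    open ZPyramid Z
    open Pyramid pyr using (P; sep; tri)

    leg-top : ∀ i → leg Z i (legLen Z i) ≡ a
    leg-top i = trans (reversed-len (P i)) (trans (proj₁ (Pyramid.ends pyr i)) apexA)

    leg-base : ∀ i → leg Z i 0 ≡ Pyramid.b pyr i
    leg-base i = trans (reversed-0 (P i)) (proj₂ (Pyramid.ends pyr i))

    leg≢a : ∀ i {k} → k < legLen Z i → leg Z i k ≢ a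
    leg≢a i k< eq = <-irrefl (reversed-injective (P i) (<⇒≤ k<) ≤-refl (trans eq (≡-sym (leg-top i)))) k<

    -- By `side`, the leaf cannot be reached from `v` without the edge to `w i`, so `Λ i` uses it;
    -- the direction is forced because `Λ i` starts at `v`.
    firstEdge : ∀ i → ∃[ κ ] (vx (Λ i) (inject₁ κ) ≡ v × vx (Λ i) (suc κ) ≡ w i)
    firstEdge i with any? (λ κ → sameEdge? (vx (Λ i) (inject₁ κ)) (vx (Λ i) (suc κ)) v (w i))
    ... | no none = ⊥-elim (side i (Λ i , proj₁ (Λends i) , proj₂ (Λends i) , λ κ same → none (κ , same)))
    ... | yes (κ , inj₁ eqs) = κ , eqs
    ... | yes (κ , inj₂ (_ , eq)) with inj (Λ i) (suc κ) zero (trans eq (≡-sym (proj₁ (Λends i))))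
    ...   | ()

    leg-inside : ∀ i {k} → k < legLen Z i → inE ζ v (w i) (leg Z i k) ⊎ Off (leg Z i k)
    leg-inside i {k} k< with firstEdge i | Γin i (leg Z i k) (reversed-onPath (P i) k) (leg≢a i k<)
    ... | κ₀ , eqv , eqw | κ , ∈ with κ Fin.≟ κ₀
    ...   | yes refl = inj₁ (subst₂ (λ c d → inE ζ c d (leg Z i k)) eqv eqw ∈)
    ...   | no κ≢ = inj₂ (_ , _ , edge , ≢v₁ , ≢v₂ , ∈)
      where
      edge : E T (vx (Λ i) (inject₁ κ)) (vx (Λ i) (suc κ))
      edge = proj₂ (adjIff (Λ i) (inject₁ κ) (suc κ)) (inj₂ (cong suc (≡-sym (Fin.toℕ-inject₁ κ))))
      ≢v₁ : vx (Λ i) (inject₁ κ) ≢ v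
      ≢v₁ eq = κ≢ (Fin.inject₁-injective (inj (Λ i) _ _ (trans eq (≡-sym eqv))))
      ≢v₂ : vx (Λ i) (suc κ) ≢ v
      ≢v₂ eq with inj (Λ i) (suc κ) zero (trans eq (≡-sym (proj₁ (Λends i))))
      ... | ()

    stripArm : ∀ i → StripArm (w i) (legLen Z i) (leg Z i)
    stripArm i = record
      { arm = subst (λ x → Arm G x (legLen Z i) (leg Z i)) (trans (proj₁ (Pyramid.ends pyr i)) apexA)
                (reversed-arm (P i) (≤-trans (s≤s (proj₁ (proj₂ deep))) (proj₁ (proj₂ (proj₂ deep)))))
      ; root = subst (inEV ζ v (w i) v) (≡-sym (leg-base i)) (baseIn i)
      ; inside = λ {k} → leg-inside i {k}
      ; uniqV = λ k< l< k∈ l∈ → unique (proj₁ (proj₂ ends′)) k< l< k∈ l∈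
      ; uniqW = λ k< l< k∈ l∈ → unique (proj₂ (proj₂ (proj₂ ends′))) k< l< k∈ l∈
      ; deep = deep }
      where
      κ = proj₁ (firstEdge i)
      eqv = proj₁ (proj₂ (firstEdge i))
      eqw = proj₂ (proj₂ (firstEdge i))
      R = proj₁ (rungs i κ)
      isRung : IsRung ζ v (w i) R
      isRung = subst₂ (λ c d → IsRung ζ c d R) eqv eqw (proj₁ (proj₂ (rungs i κ)))
      iff : ∀ x → Iff (onPath R x) (onPath (P i) x × x ≢ a × inE ζ v (w i) x)
      iff = subst₂ (λ c d → ∀ x → Iff (onPath R x) (onPath (P i) x × x ≢ a × inE ζ c d x)) eqv eqw
              (proj₁ (proj₂ (proj₂ (rungs i κ))))
      1≤R : 1 ≤ len R
      1≤R = proj₂ (proj₂ (proj₂ (rungs i κ))) (inj₁ (eqv , eqw))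
      ends′ = rung-ends ζ {R = R} isRung (λ eq → <-irrefl (≡-sym eq) 1≤R)
      onR : ∀ {k} → k < legLen Z i → inE ζ v (w i) (leg Z i k) → onPath R (leg Z i k)
      onR {k} k< ∈ = proj₂ (iff _) (reversed-onPath (P i) k , leg≢a i k< , ∈)
      unique : ∀ {z r} → (∀ j → inEV ζ v (w i) z (vx R j) → j ≡ r) → ∀ {k l} → k < legLen Z i → l < legLen Z i →
               inEV ζ v (w i) z (leg Z i k) → inEV ζ v (w i) z (leg Z i l) → k ≡ l
      unique {z} one k< l< k∈ l∈ with onR k< (s3sub _ _ (vw i) _ _ k∈) | onR l< (s3sub _ _ (vw i) _ _ l∈)
      ... | j , eqk | j′ , eql = reversed-injective (P i) (<⇒≤ k<) (<⇒≤ l<)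
        (trans (≡-sym eqk) (trans (cong (vx R) (trans (one j (subst (inEV ζ v (w i) z) (≡-sym eqk) k∈))
          (≡-sym (one j′ (subst (inEV ζ v (w i) z) (≡-sym eql) l∈))))) eql))
      located : ∀ j → ∃[ k ] (k < legLen Z i × vx R j ≡ leg Z i k)
      located j with proj₁ (iff (vx R j)) (j , refl)
      ... | (l , eq) , ≢a , _ with m≤n⇒m<n∨m≡n (m∸n≤m (legLen Z i) (toℕ l))
      ...   | inj₁ k< = _ , k< , trans (≡-sym eq) (reversed-vx (P i) l)
      ...   | inj₂ k≡ = ⊥-elim (≢a (trans (≡-sym eq) (trans (reversed-vx (P i) l) (trans (cong (leg Z i) k≡) (leg-top i)))))
      deep : ∃[ k ] (1 ≤ k × k < legLen Z i × inE ζ v (w i) (leg Z i k))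
      -- The two ends of a long rung are distinct, so at least one of them has a positive index on
      -- the leg.
      deep with located zero | located (fromℕ (len R))
      ... | suc k , k< , eq | _ = suc k , s≤s z≤n , k< , subst (inE ζ v (w i)) eq (proj₁ isRung _ (zero , refl))
      ... | zero , _ , _ | suc l , l< , eq′ = suc l , s≤s z≤n , l< , subst (inE ζ v (w i)) eq′ (proj₁ isRung _ (_ , refl))
      ... | zero , _ , eq | zero , _ , eq′ = ⊥-elim (<-irrefl (trans (cong toℕ (inj R _ _ (trans eq (≡-sym eq′)))) (toℕ-fromℕ (len R))) 1≤R)

    leg-meet : ∀ {i j} → i ≢ j → Meet G (legLen Z i) (leg Z i) (legLen Z j) (leg Z j)
    leg-meet {i} {j} i≢j = record
      { base = subst₂ (E G) (≡-sym (leg-base i)) (≡-sym (leg-base j)) (tri i j i≢j)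
      ; disj = λ {k} {l} k< l< → proj₁ (apart {k} {l} k< l<)
      ; only = λ {k} {l} k< l< e → let (p , q) = proj₂ (apart {k} {l} k< l<) e in
          reversed-injective (P i) (<⇒≤ k<) z≤n (trans p (≡-sym (leg-base i))) ,
          reversed-injective (P j) (<⇒≤ l<) z≤n (trans q (≡-sym (leg-base j))) }
      where
      apart : ∀ {k l} → k < legLen Z i → l < legLen Z j →
        leg Z i k ≢ leg Z j l × (E G (leg Z i k) (leg Z j l) → leg Z i k ≡ Pyramid.b pyr i × leg Z j l ≡ Pyramid.b pyr j)
      apart {k} {l} k< l< = sep i j i≢j _ _ (reversed-onPath (P i) k) (reversed-onPath (P j) l)
        (λ eq → leg≢a i {k} k< (trans eq apexA)) (λ eq → leg≢a j {l} l< (trans eq apexA))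

-- Exchanging rungs in the legs seen by a jewel

module Jewels {G T : Graph} (tf : ThetaFree G) (pf : PrismFree G) (ζ : ZetaMap G T) {a : V G}
  (S : IsStrip ζ a) (rich : Rich ζ a) {v : V T} (¬leaf : ¬ Leaf T v) where
  open IsStrip S
  open Strip ζ S rich ¬leaf

  -- Replaces the rung of u in ζ(vw) by that of q. Shortcuts between the old and the new part are
  -- allowed: only the first edge and the last vertex before a matter below.
  module Swap {w : V T} {M M′ : ℕ} {u q : ℕ → V G} (vw : E T v w) (A : StripArm w M u) (B : StripArm w M′ q) where
    private
      module A = StripArm A
      module B = StripArm B
      module A′ = Split (split vw A)
      module B′ = Split (split vw B)

    X : Pred G
    X x = x ≡ a ⊎ Seg {G} q 0 (suc B′.m) x ⊎ Seg {G} u (suc A′.m) M x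

    q-exit : ∀ {l z} → l ≤ B′.m → Outside z → E G (q l) z → l ≡ B′.m
    q-exit l≤ out e = B.uniqW (≤-<-trans l≤ B′.m<M) B′.m<M (exit vw (B′.initial l≤) out e) B′.exitEnd

    abstract
      route : InducedIn G X a (q 0)
      route = inducedPath {X = X} (reverseʷ (joinʷ
        (ascend B.arm z≤n (<⇒≤ B′.m<M) (λ k _ k≤m → inj₂ (inj₁ (k , z≤n , s≤s k≤m , refl))))
        -- The joining edge: the last vertex of the new rung sees the next vertex of `u` because the
        -- last vertex of the old rung does.
        (transfer vw A′.exitEnd B′.exitEnd (A′.final ≤-refl A′.m<M) (A.link A′.m<M))
        (ascendTop A.arm A′.m<M (λ k m<k k<M → inj₂ (inj₂ (k , m<k , k<M , refl))) (inj₁ refl))))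

    N : ℕ
    N = len (proj₁ route)

    y : ℕ → V G
    y = reversed (proj₁ route)

    y∈X : ∀ k → X (y k)
    y∈X k = proj₂ (proj₂ (proj₂ route)) (fromℕ< (s≤s (m∸n≤m N k)))

    arm : Arm G a N y
    arm = subst (λ x → Arm G x N y) (proj₁ (proj₂ route)) (reversed-arm (proj₁ route)
      (long-induced {Y = X} (λ eq → top-apart B.arm (<-trans (s≤s z≤n) B.long) (≡-sym eq))
        (λ e → <-irrefl (top-near B.arm z≤n (E-sym G e)) B.long) route))
    private module Y = Arm arm

    y0 : y 0 ≡ q 0
    y0 = trans (reversed-0 (proj₁ route)) (proj₁ (proj₂ (proj₂ route)))

    -- Inside `X` the only neighbour of `q 0` is `q 1`: vertices of the tail are seen only by the
    -- last vertex of the new rung, and that rung is long.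
    y1 : y 1 ≡ q 1
    y1 with y∈X 1 | subst (λ x → E G x (y 1)) y0 (Y.link (<-trans (s≤s z≤n) Y.long))
    ... | inj₁ eq | _ = ⊥-elim (top-apart arm Y.long eq)
    ... | inj₂ (inj₁ (l , _ , s≤s l≤m , eq)) | e with B.near z≤n (≤-trans l≤m (<⇒≤ B′.m<M)) (subst (E G (q 0)) eq e)
    ...   | inj₂ refl = eq
    y1 | inj₂ (inj₂ (l , m<l , l<M , eq)) | e =
      ⊥-elim (<-irrefl (q-exit z≤n (A′.final m<l (<⇒≤ l<M)) (subst (E G (q 0)) eq e)) B′.1≤m)

    inZ : ∀ {x} → X x → inZT+ ζ a x
    inZ (inj₁ eq) = inj₁ eq
    inZ (inj₂ (inj₁ (l , _ , s≤s l≤m , refl))) = inj₂ (inj₂ (v , w , vw , B′.initial l≤m))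
    inZ (inj₂ (inj₂ (l , _ , l<M , refl))) with A.inside l<M
    ... | inj₁ ∈ = inj₂ (inj₂ (v , w , vw , ∈))
    ... | inj₂ (c , d , cd , _ , _ , ∈) = inj₂ (inj₂ (c , d , cd , ∈))

    -- If `y` reaches `a` from the tail of `u`, both vertices are the one before the apex on `u`.
    -- Otherwise it reaches `a` from the new rung, so `w` is a leaf, and by richness the old and the
    -- new rung end in the same vertex.
    lastVertex : ∀ {l k} → l < M → E G (u l) a → k < N → E G (y k) a → u l ≡ y k
    lastVertex {l} {k} l<M u~a k<N y~a with y∈X k
    ... | inj₁ eq = ⊥-elim (top-apart arm k<N eq)
    ... | inj₂ (inj₂ (l′ , _ , l′<M , eq)) = trans
      (cong u (suc-injective (trans (top-near A.arm (<⇒≤ l<M) u~a)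
        (≡-sym (top-near A.arm (<⇒≤ l′<M) (subst (λ x → E G x a) eq y~a)))))) (≡-sym eq)
    ... | inj₂ (inj₁ (l′ , _ , s≤s l′≤m , eq)) = trans (cong u l≡m) (trans (≡-sym q≡um) (≡-sym eq))
      where
      q~a = subst (λ x → E G x a) eq y~a
      q≡um : q l′ ≡ u A′.m
      q≡um = leafEnd-unique vw (exit vw (B′.initial l′≤m) (inj₁ refl) q~a) A′.exitEnd q~a
      l≡m : l ≡ A′.m
      l≡m = suc-injective (trans (top-near A.arm (<⇒≤ l<M) u~a)
              (≡-sym (top-near A.arm (<⇒≤ A′.m<M) (subst (λ x → E G x a) q≡um q~a))))

    toTop : ∀ {k} → suc k ≡ N → E G (y k) a
    toTop {k} eq = subst (E G (y k)) (trans (cong y eq) Y.top) (Y.link (≤-reflexive eq))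

    -- As `a` is trapped, its neighbour `y (suc k)` has degree two in `ζ⁺(T)`, and `a` and `y k` use
    -- up both places.
    noThirdNeighbour : ∀ k → suc (suc k) ≡ N → ∀ {x} → inZT+ ζ a x → x ≢ a → x ≢ y k → ¬ E G x (y (suc k))
    noThirdNeighbour k eq {x} x∈ x≢a x≢y e with proj₂ (proj₁ rich) (y (suc k)) (E-sym G (toTop eq))
    ... | z₁ , z₂ , _ , _ , _ , _ , _ , two
      with two a (inj₁ refl) (toTop eq) | two (y k) (inZ (y∈X k)) (E-sym G (Y.link (≤-trans (n≤1+n _) (≤-reflexive eq))))
         | two x x∈ (E-sym G e)
    ... | inj₁ p | _ | inj₁ q = x≢a (trans q (≡-sym p))
    ... | inj₂ p | _ | inj₂ q = x≢a (trans q (≡-sym p))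
    ... | _ | inj₁ p | inj₁ q = x≢y (trans q (≡-sym p))
    ... | _ | inj₂ p | inj₂ q = x≢y (trans q (≡-sym p))
    ... | inj₁ p | inj₁ q | inj₂ _ = top-apart arm (≤-trans (n≤1+n _) (≤-reflexive eq)) (trans q (≡-sym p))
    ... | inj₂ p | inj₂ q | inj₁ _ = top-apart arm (≤-trans (n≤1+n _) (≤-reflexive eq)) (trans q (≡-sym p))

    low : ∀ {l k} → l < M → (∀ {k} → k ≤ N → u l ≢ y k) → k ≤ N → E G (u l) (y k) → suc k < N
    low {l} {k} l<M l∉ k≤N e with m≤n⇒m<n∨m≡n k≤N
    ... | inj₂ refl = ⊥-elim (beforeTop N refl Y.long)
      where
      beforeTop : ∀ n → n ≡ N → 2 ≤ n → ⊥
      beforeTop (suc n) eq _ = l∉ (≤-trans (n≤1+n n) (≤-reflexive eq))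
        (lastVertex l<M (subst (E G (u l)) Y.top e) (≤-reflexive eq) (toTop eq))
    ... | inj₁ k<N with m≤n⇒m<n∨m≡n k<N
    ...   | inj₁ sk<N = sk<N
    low {l} {zero} l<M l∉ k≤N e | inj₁ k<N | inj₂ eq = ⊥-elim (<-irrefl eq Y.long)
    low {l} {suc k} l<M l∉ k≤N e | inj₁ k<N | inj₂ eq =
      ⊥-elim (noThirdNeighbour k eq u∈ (top-apart A.arm l<M) (l∉ (≤-trans (n≤1+n k) k≤N)) e)
      where
      u∈ : inZT+ ζ a (u l)
      u∈ with A.inside l<M
      ... | inj₁ ∈ = inj₂ (inj₂ (v , w , vw , ∈))
      ... | inj₂ (c , d , cd , _ , _ , ∈) = inj₂ (inj₂ (c , d , cd , ∈))

    -- Tail vertices inherit the condition from `u`. An edge from the new rung to a vertex of `r`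
    -- off `v` would transfer to the last vertex of the old rung, whose index is positive. An edge
    -- between the two strips at `v` joins `ζ(vw,v)` to `ζ(vw′,v)`, and the legs have only their
    -- base vertices there.
    meet : ∀ {w′ L r} → E T v w′ → w ≢ w′ → StripArm w′ L r → Meet G M u L r → Meet G N y L r
    meet {w′} {L} {r} vw′ w≢w′ C R = record
      { base = subst (λ x → E G x (r 0)) (≡-sym y0) (s4comp _ _ _ _ vw vw′ ¬same v _ _ B.root C.root)
      ; disj = λ {k} k<N l<L → proj₁ (apart k<N l<L)
      ; only = λ {k} k<N l<L → proj₂ (apart k<N l<L) }
      where
      module C = StripArm C
      ¬same : ¬ SameEdge v w v w′
      ¬same (inj₁ (_ , eq)) = w≢w′ eq
      ¬same (inj₂ (refl , _)) = E-irrefl T vw′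
      new : ∀ {k l} → k ≤ B′.m → l < L → q k ≢ r l × (E G (q k) (r l) → k ≡ 0 × l ≡ 0)
      new {k} {l} k≤m l<L with C.inside l<L
      ... | inj₂ off =
        (λ eq → off-notIn vw off (subst (inE ζ v w) eq (B′.initial k≤m))) ,
        λ e → ⊥-elim (<-irrefl (≡-sym (proj₁ (Meet.only R A′.m<M l<L
          (transfer vw (exit vw (B′.initial k≤m) (inj₂ off) e) A′.exitEnd (inj₂ off) e)))) A′.1≤m)
      ... | inj₁ ∈ =
        (λ eq → s1EE _ _ _ _ vw vw′ ¬same _ (B′.initial k≤m) (subst (inE ζ v w′) (≡-sym eq) ∈)) ,
        λ e → atV (s4only _ _ _ _ vw vw′ ¬same _ _ (B′.initial k≤m) ∈ e)
        where
        atV : ∃[ z ] (inEV ζ v w z (q k) × inEV ζ v w′ z (r l)) → k ≡ 0 × l ≡ 0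
        atV (z , ∈q , ∈r) with proj₁ (s3ne v w vw z) (_ , ∈q)
        ... | inj₁ refl = B.uniqV (≤-<-trans k≤m B′.m<M) (≤-<-trans z≤n B′.m<M) ∈q B.root , C.uniqV l<L (≤-<-trans z≤n l<L) ∈r C.root
        ... | inj₂ refl with proj₁ (s3ne v w′ vw′ z) (_ , ∈r)
        ...   | inj₁ refl = ⊥-elim (E-irrefl T vw)
        ...   | inj₂ eq = ⊥-elim (w≢w′ eq)
      apart : ∀ {k l} → k < N → l < L → y k ≢ r l × (E G (y k) (r l) → k ≡ 0 × l ≡ 0)
      apart {k} {l} k<N l<L with y∈X k
      ... | inj₁ eq = ⊥-elim (top-apart arm k<N eq)
      ... | inj₂ (inj₁ (i , _ , s≤s i≤m , eq)) =
        (λ yr → proj₁ (new i≤m l<L) (trans (≡-sym eq) yr)) , λ e → first (proj₂ (new i≤m l<L) (subst (λ x → E G x (r l)) eq e))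
        where
        first : i ≡ 0 × l ≡ 0 → k ≡ 0 × l ≡ 0
        first (refl , l≡0) = Y.distinct (<⇒≤ k<N) z≤n (trans eq (≡-sym y0)) , l≡0
      ... | inj₂ (inj₂ (i , m<i , i<M , eq)) =
        (λ yr → Meet.disj R i<M l<L (trans (≡-sym eq) yr)) ,
        λ e → ⊥-elim (<-irrefl (≡-sym (proj₁ (Meet.only R i<M l<L (subst (λ x → E G x (r l)) eq e)))) (≤-<-trans z≤n m<i))

  module _ {w : Fin 3 → V T} (Z : ZPyramid ζ a v w) (vw : ∀ i → E T v (w i)) where
    private pyr = ZPyramid.pyr Z

    jewel-leg : ∀ {k p} → PyrJewel G pyr k p → ∀ {i} → i ≢ k →
      E G p (leg Z i 0) × E G p (leg Z i 1) × (∀ {l} → l ≤ legLen Z i → E G p (leg Z i l) → l ≤ 1)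
    jewel-leg {k} {p} (_ , _ , J) {i} i≢k =
      back 0 (inj₁ (leg-base Z vw i)) ,
      back 1 (inj₂ (subst (λ x → E G x (leg Z i 1)) (leg-base Z vw i) (link (<-trans (s≤s z≤n) long)))) ,
      λ {l} l≤ e → front l≤ (proj₁ (J i i≢k (leg Z i l) (reversed-onPath (Pyramid.P pyr i) l)) e)
      where
      open StripArm (stripArm Z vw i)
      back : ∀ l → leg Z i l ≡ Pyramid.b pyr i ⊎ E G (Pyramid.b pyr i) (leg Z i l) → E G p (leg Z i l)
      back l = proj₂ (J i i≢k (leg Z i l) (reversed-onPath (Pyramid.P pyr i) l))
      front : ∀ {l} → l ≤ legLen Z i → leg Z i l ≡ Pyramid.b pyr i ⊎ E G (Pyramid.b pyr i) (leg Z i l) → l ≤ 1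
      front l≤ (inj₁ eq) = ≤-trans (≤-reflexive (distinct l≤ z≤n (trans eq (≡-sym (leg-base Z vw i))))) z≤n
      front {l} l≤ (inj₂ e) with near z≤n l≤ (subst (λ x → E G x (leg Z i l)) (≡-sym (leg-base Z vw i)) e)
      ... | inj₂ eq = ≤-reflexive eq

    jewel-attached : (∀ i j → i ≢ j → w i ≢ w j) → ∀ {i j k} → i ≢ j → i ≢ k → j ≢ k →
      ∀ {p} → ¬ inZT+ ζ a p → PyrJewel G pyr k p →
      ∀ {M q} → StripArm (w i) M q → E G p (q 0) × E G p (q 1)
    jewel-attached w-inj {i} {j} {k} i≢j i≢k j≢k {p} p∉Z J {M} {q} B =
      let (e₀ , e₁) = R.attached in subst (E G p) W.y0 e₀ , subst (E G p) W.y1 e₁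
      where
      arm : ∀ i → StripArm (w i) (legLen Z i) (leg Z i)
      arm = stripArm Z vw
      module W = Swap (vw i) (arm i) B
      offY : ∀ {l} → l ≤ W.N → p ≢ W.y l
      offY {l} _ eq = p∉Z (subst (inZT+ ζ a) (≡-sym eq) (W.inZ (W.y∈X l)))
      off : ∀ i {l} → l ≤ legLen Z i → p ≢ leg Z i l
      off i {l} _ eq = proj₁ J i (subst (onPath (Pyramid.P pyr i)) (≡-sym eq) (reversed-onPath (Pyramid.P pyr i) l))
      anti : ∀ {l} → l ≤ legLen Z k → ¬ E G p (leg Z k l)
      anti {l} _ = proj₁ (proj₂ J) (leg Z k l) (reversed-onPath (Pyramid.P pyr k) l)
      -- A neighbour among the last two vertices of the new leg would put `p` within distance two of
      -- `a`, hence into `ζ⁺(T)`.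
      lowP : ∀ {l} → l ≤ W.N → E G p (W.y l) → suc l < W.N
      lowP {l} l≤N e with m≤n⇒m<n∨m≡n l≤N
      ... | inj₂ refl = ⊥-elim (p∉Z (proj₁ (proj₁ rich) p (inj₂ (inj₁ (E-sym G (subst (E G p) (Arm.top W.arm) e))))))
      ... | inj₁ l<N with m≤n⇒m<n∨m≡n l<N
      ...   | inj₁ sl<N = sl<N
      ...   | inj₂ eq = ⊥-elim (p∉Z (proj₁ (proj₁ rich) p (inj₂ (inj₂ (W.y l , E-sym G (W.toTop eq) , E-sym G e)))))
      module R = Rerouting tf pf W.arm (StripArm.arm (arm i)) (StripArm.arm (arm j)) (StripArm.arm (arm k))
        (W.meet (vw j) (w-inj i j i≢j) (arm j) (leg-meet Z vw i≢j))
        (W.meet (vw k) (w-inj i k i≢k) (arm k) (leg-meet Z vw i≢k))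
        (leg-meet Z vw j≢k) (leg-meet Z vw i≢j) (leg-meet Z vw i≢k)
        p (proj₁ (proj₂ (jewel-leg J i≢k))) (proj₁ (jewel-leg J j≢k)) (proj₁ (proj₂ (jewel-leg J j≢k)))
        offY (off i) (off j) (off k) (proj₂ (proj₂ (jewel-leg J j≢k))) anti lowP W.low

-- Counting

-- Applied to `adj T v`, this numbers the neighbours of `v` by the naturals below its degree.
rank : ∀ {m} → (Fin m → Bool) → Fin m → ℕ
rank f zero = 0
rank f (suc i) = (if f zero then 1 else 0) + rank (λ i → f (suc i)) i

rank<count : ∀ {m} (f : Fin m → Bool) i → f i ≡ true → rank f i < count f
rank<count f zero fi rewrite fi = s≤s z≤n
rank<count f (suc i) fi = +-monoʳ-< (if f zero then 1 else 0) (rank<count (λ i → f (suc i)) i fi)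

rank-injective : ∀ {m} (f : Fin m → Bool) i j → f i ≡ true → f j ≡ true → rank f i ≡ rank f j → i ≡ j
rank-injective f zero zero _ _ _ = refl
rank-injective f zero (suc j) fi _ eq rewrite fi with eq
... | ()
rank-injective f (suc i) zero _ fj eq rewrite fj with eq
... | ()
rank-injective f (suc i) (suc j) fi fj eq =
  cong suc (rank-injective (λ i → f (suc i)) i j fi fj (+-cancelˡ-≡ (if f zero then 1 else 0) _ _ eq))

two-neighbours-notLeaf : ∀ {T} {v w w′ : V T} → E T v w → E T v w′ → w ≢ w′ → ¬ Leaf T v
two-neighbours-notLeaf {T} {v} {w} {w′} vw vw′ w≢w′ leaf =
  w≢w′ (rank-injective (adj T v) w w′ vw vw′ (trans (least-rank w vw) (≡-sym (least-rank w′ vw′))))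
  where
  least-rank : ∀ w → E T v w → rank (adj T v) w ≡ 0
  least-rank w vw = n<1⇒n≡0 (subst (rank (adj T v) w <_) leaf (rank<count (adj T v) w vw))

suc-C2 : ∀ n → suc n C 2 ≡ n C 2 + n
suc-C2 n = trans (≡-sym (nCk+nC[k+1]≡[n+1]C[k+1] n 1)) (trans (+-comm (n C 1) (n C 2)) (cong (n C 2 +_) (nC1≡n n)))

C2-mono : ∀ {m n} → m ≤ n → m C 2 ≤ n C 2
C2-mono {n = zero} z≤n = z≤n
C2-mono {m} {n = suc n} m≤ with m≤n⇒m<n∨m≡n m≤
... | inj₁ (s≤s m≤n) = ≤-trans (C2-mono m≤n) (≤-trans (m≤m+n (n C 2) n) (≤-reflexive (≡-sym (suc-C2 n))))
... | inj₂ refl = ≤-refl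

-- Combinatorial number system of degree two: by Pascal's rule the pairs with larger entry `hi` fill
-- exactly the block from `hi C 2` up to `suc hi C 2`.
C2-step : ∀ {lo hi n} → lo < hi → hi < n → hi C 2 + lo < n C 2
C2-step {lo} {hi} lo<hi hi<n =
  <-≤-trans (+-monoʳ-< (hi C 2) lo<hi) (≤-trans (≤-reflexive (≡-sym (suc-C2 hi))) (C2-mono hi<n))

C2-unique : ∀ {lo hi lo′ hi′} → lo < hi → lo′ < hi′ → hi C 2 + lo ≡ hi′ C 2 + lo′ → hi ≡ hi′ × lo ≡ lo′
C2-unique {lo} {hi} {lo′} {hi′} l l′ eq with <-cmp hi hi′
... | tri< hi<hi′ _ _ = ⊥-elim (<-irrefl eq (<-≤-trans (C2-step l hi<hi′) (m≤m+n _ lo′)))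
... | tri> _ _ hi′<hi = ⊥-elim (<-irrefl (≡-sym eq) (<-≤-trans (C2-step l′ hi′<hi) (m≤m+n _ lo)))
... | tri≈ _ refl _ = refl , +-cancelˡ-≡ (hi C 2) lo lo′ eq

-- Enumerates the unordered pairs of distinct numbers below n by the numbers below n C 2.
pairCode : ℕ → ℕ → ℕ
pairCode r s = (r ⊔ s) C 2 + (r ⊓ s)

⊓<⊔ : ∀ {r s} → r ≢ s → r ⊓ s < r ⊔ s
⊓<⊔ {r} {s} r≢s with ≤-total r s
... | inj₁ r≤s rewrite m≤n⇒m⊔n≡n r≤s | m≤n⇒m⊓n≡m r≤s = ≤∧≢⇒< r≤s r≢s
... | inj₂ s≤r rewrite m≥n⇒m⊔n≡m s≤r | m≥n⇒m⊓n≡n s≤r = ≤∧≢⇒< s≤r (≢-sym r≢s)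

pairCode< : ∀ {r s n} → r ≢ s → r < n → s < n → pairCode r s < n C 2
pairCode< r≢s r<n s<n = C2-step (⊓<⊔ r≢s) (⊔-lub r<n s<n)

pairCode-injective : ∀ {r s r′ s′} → r ≢ s → r′ ≢ s′ → pairCode r s ≡ pairCode r′ s′ → SameEdge r s r′ s′
pairCode-injective {r} {s} {r′} {s′} ne ne′ eq with C2-unique (⊓<⊔ ne) (⊓<⊔ ne′) eq
... | hi , lo with ≤-total r s | ≤-total r′ s′
...   | inj₁ p | inj₁ q rewrite m≤n⇒m⊔n≡n p | m≤n⇒m⊓n≡m p | m≤n⇒m⊔n≡n q | m≤n⇒m⊓n≡m q = inj₁ (lo , hi)
...   | inj₁ p | inj₂ q rewrite m≤n⇒m⊔n≡n p | m≤n⇒m⊓n≡m p | m≥n⇒m⊔n≡m q | m≥n⇒m⊓n≡n q = inj₂ (lo , hi)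
...   | inj₂ p | inj₁ q rewrite m≥n⇒m⊔n≡m p | m≥n⇒m⊓n≡n p | m≤n⇒m⊔n≡n q | m≤n⇒m⊓n≡m q = inj₂ (hi , lo)
...   | inj₂ p | inj₂ q rewrite m≥n⇒m⊔n≡m p | m≥n⇒m⊓n≡n p | m≥n⇒m⊔n≡m q | m≥n⇒m⊓n≡n q = inj₁ (hi , lo)

Selection : ∀ {A : Set} → (A → Set) → ℕ → Set
Selection {A} P r = Σ (Fin r → A) λ g → (∀ i j → g i ≡ g j → i ≡ j) × (∀ i → P (g i))

shorten : ∀ {A : Set} {P : A → Set} {r k} → r ≤ k → Selection P k → Selection P r
shorten r≤k (g , g-inj , Pg) =
  (λ i → g (inject≤ i r≤k)) , (λ i j eq → Fin.inject≤-injective r≤k r≤k i j (g-inj _ _ eq)) , λ i → Pg _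

shift : ∀ {k r} {P : Fin (suc k) → Set} → Selection (λ i → P (suc i)) r → Selection P r
shift (g , g-inj , Pg) = (λ i → suc (g i)) , (λ i j eq → g-inj i j (Fin.suc-injective eq)) , Pg

prepend : ∀ {k r} {P : Fin (suc k) → Set} → P zero → Selection (λ i → P (suc i)) r → Selection P (suc r)
prepend {k} {r} {P} P0 (g , g-inj , Pg) = h , h-inj , λ { zero → P0 ; (suc i) → Pg i }
  where
  h : Fin (suc r) → Fin (suc k)
  h zero = zero
  h (suc i) = suc (g i)
  h-inj : ∀ i j → h i ≡ h j → i ≡ j
  h-inj zero zero _ = refl
  h-inj (suc i) (suc j) eq = cong suc (g-inj i j (Fin.suc-injective eq))

partition : ∀ k {P Q : Fin k → Set} → (∀ i → P i ⊎ Q i) →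
            ∃[ k₁ ] ∃[ k₂ ] (k₁ + k₂ ≡ k × Selection P k₁ × Selection Q k₂)
partition zero _ = 0 , 0 , refl , ((λ ()) , (λ ()) , λ ()) , ((λ ()) , (λ ()) , λ ())
partition (suc k) {P} {Q} c with partition k (λ i → c (suc i)) | c zero
... | k₁ , k₂ , eq , σ , τ | inj₁ P0 = suc k₁ , k₂ , cong suc eq , prepend {P = P} P0 σ , shift {P = Q} τ
... | k₁ , k₂ , eq , σ , τ | inj₂ Q0 = k₁ , suc k₂ , trans (+-suc k₁ k₂) (cong suc eq) , shift {P = P} σ , prepend {P = Q} Q0 τ

large-part : ∀ {k₁ k₂ r₁ r₂} → r₁ + r₂ ≤ k₁ + k₂ → r₁ ≤ k₁ ⊎ r₂ ≤ k₂
large-part {k₁} {k₂} {r₁} {r₂} le with ≤-total r₁ k₁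
... | inj₁ r₁≤k₁ = inj₁ r₁≤k₁
... | inj₂ k₁≤r₁ = inj₂ (+-cancelˡ-≤ k₁ r₂ k₂ (≤-trans (+-monoˡ-≤ r₂ k₁≤r₁) le))

pigeonhole : ∀ N r k (c : Fin k → ℕ) → (∀ i → c i < suc N) → suc N * r ≤ k → ∃[ b ] Selection (λ i → c i ≡ b) r
pigeonhole zero r k c c<1 le =
  0 , shorten (≤-trans (≤-reflexive (≡-sym (+-identityʳ r))) le) ((λ i → i) , (λ _ _ eq → eq) , λ i → n<1⇒n≡0 (c<1 i))
pigeonhole (suc N) r k c c< le with partition k {λ i → c i ≡ suc N} {λ i → c i < suc N} topOrBelow
  where
  topOrBelow : ∀ i → c i ≡ suc N ⊎ c i < suc N
  topOrBelow i with m≤n⇒m<n∨m≡n (≤-pred (c< i))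
  ... | inj₁ l = inj₂ l
  ... | inj₂ eq = inj₁ eq
... | k₁ , k₂ , refl , σ , (g , g-inj , below) with large-part {k₁} {k₂} le
...   | inj₁ r≤k₁ = suc N , shorten {P = λ i → c i ≡ suc N} r≤k₁ σ
...   | inj₂ le₂ with pigeonhole N r k₂ (λ i → c (g i)) below le₂
...     | b , h , h-inj , hb = b , (λ i → g (h i)) , (λ i j eq → h-inj i j (g-inj _ _ eq)) , hb

-- Ramsey's theorem

induced : (G : Graph) → ∀ {k} → (Fin k → V G) → Graph
induced G {k} f = record
  { n = k ; adj = λ i j → adj G (f i) (f j) ; sym = λ i j → sym G (f i) (f j) ; irrefl = λ i → irrefl G (f i) }

cons-clique : ∀ {G p x} ((f , _) : HasClique G p) → (∀ i → E G x (f i)) → HasClique G (suc p)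
cons-clique {G} {p} {x} (f , f-inj , f-adj) x~f = h , h-inj , h-adj
  where
  h : Fin (suc p) → V G
  h zero = x
  h (suc i) = f i
  x≢f : ∀ i → x ≢ f i
  x≢f i eq = E-irrefl G (subst (E G x) (≡-sym eq) (x~f i))
  h-inj : ∀ i j → h i ≡ h j → i ≡ j
  h-inj zero zero _ = refl
  h-inj zero (suc j) eq = ⊥-elim (x≢f j eq)
  h-inj (suc i) zero eq = ⊥-elim (x≢f i (≡-sym eq))
  h-inj (suc i) (suc j) eq = cong suc (f-inj i j eq)
  h-adj : ∀ i j → i ≢ j → E G (h i) (h j)
  h-adj zero zero ne = ⊥-elim (ne refl)
  h-adj zero (suc j) _ = x~f j
  h-adj (suc i) zero _ = E-sym G (x~f i)
  h-adj (suc i) (suc j) ne = f-adj i j (λ eq → ne (cong suc eq))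

cons-stable : ∀ {G q x} ((f , _) : HasStable G q) → (∀ i → x ≢ f i) → (∀ i → ¬ E G x (f i)) → HasStable G (suc q)
cons-stable {G} {q} {x} (f , f-inj , f-anti) x≢f x≁f = h , h-inj , h-anti
  where
  h : Fin (suc q) → V G
  h zero = x
  h (suc i) = f i
  h-inj : ∀ i j → h i ≡ h j → i ≡ j
  h-inj zero zero _ = refl
  h-inj zero (suc j) eq = ⊥-elim (x≢f j eq)
  h-inj (suc i) zero eq = ⊥-elim (x≢f i (≡-sym eq))
  h-inj (suc i) (suc j) eq = cong suc (f-inj i j eq)
  h-anti : ∀ i j → ¬ E G (h i) (h j)
  h-anti zero zero = E-irrefl G
  h-anti zero (suc j) = x≁f j
  h-anti (suc i) zero e = x≁f i (E-sym G e)
  h-anti (suc i) (suc j) = f-anti i j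

lift-clique : ∀ {G k p} (f : Fin k → V G) → (∀ i j → f i ≡ f j → i ≡ j) → HasClique (induced G f) p → HasClique G p
lift-clique f f-inj (g , g-inj , g-adj) = (λ i → f (g i)) , (λ i j eq → g-inj i j (f-inj _ _ eq)) , g-adj

lift-stable : ∀ {G k q} (f : Fin k → V G) → (∀ i j → f i ≡ f j → i ≡ j) → HasStable (induced G f) q → HasStable G q
lift-stable f f-inj (g , g-inj , g-anti) = (λ i → f (g i)) , (λ i j eq → g-inj i j (f-inj _ _ eq)) , g-anti

-- The usual recursion: among `r₁ + r₂` vertices other than `zero`, either `r₁` are neighbours of
-- `zero` or `r₂` are not. The value need not be least.
ramsey : ∀ p q → ∃[ r ] RamseyProp p q r
ramsey zero q = 0 , λ _ _ → inj₁ ((λ ()) , (λ ()) , λ ())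
ramsey (suc p) zero = 0 , λ _ _ → inj₂ ((λ ()) , (λ ()) , λ ())
ramsey (suc p) (suc q) with ramsey p (suc q) | ramsey (suc p) q
... | r₁ , R₁ | r₂ , R₂ = suc (r₁ + r₂) , bound
  where
  bound : RamseyProp (suc p) (suc q) (suc (r₁ + r₂))
  bound H@record { n = suc m } (s≤s le)
    with partition m {λ i → E H zero (suc i)} {λ i → ¬ E H zero (suc i)} neighbour?
    where
    neighbour? : ∀ i → E H zero (suc i) ⊎ ¬ E H zero (suc i)
    neighbour? i with E? H zero (suc i)
    ... | yes e = inj₁ e
    ... | no ¬e = inj₂ ¬e
  ... | k₁ , k₂ , refl , (g , g-inj , g~) , (h , h-inj , h≁) with large-part {k₁} {k₂} le
  ...   | inj₁ r₁≤ with R₁ (induced H (λ i → suc (g i))) r₁≤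
  ...     | inj₂ st = inj₂ (lift-stable {H} _ (λ i j eq → g-inj i j (Fin.suc-injective eq)) st)
  ...     | inj₁ cl@(f , _) = inj₁ (cons-clique {H} (lift-clique {H} _ (λ i j eq → g-inj i j (Fin.suc-injective eq)) cl) (λ i → g~ (f i)))
  bound H@record { n = suc m } (s≤s le) | k₁ , k₂ , refl , (g , g-inj , g~) , (h , h-inj , h≁) | inj₂ r₂≤
    with R₂ (induced H (λ i → suc (h i))) r₂≤
  ... | inj₁ cl = inj₁ (lift-clique {H} _ (λ i j eq → h-inj i j (Fin.suc-injective eq)) cl)
  ... | inj₂ st@(f , _) = inj₂ (cons-stable {H} (lift-stable {H} _ (λ i j eq → h-inj i j (Fin.suc-injective eq)) st)
                            (λ _ ()) (λ i → h≁ (f i)))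

-- Counting the jewels at a vertex of the tree

module _ {G T : Graph} (tf : ThetaFree G) (pf : PrismFree G) (ζ : ZetaMap G T) {a : V G}
  (S : IsStrip ζ a) (rich : Rich ζ a) {v : V T} where

  module _ (¬leaf : ¬ Leaf T v) where
    open Strip ζ S rich {v} ¬leaf

    AttachedTo : V G → (ℕ → V G) → Set
    AttachedTo p q = E G p (q 0) × E G p (q 1)

    private module _ {w₁ w₂ : V T} (vw₁ : E T v w₁) (vw₂ : E T v w₂) (w₁≢w₂ : w₁ ≢ w₂) where

      pick : ∀ {w₃} → E T v w₃ → ∀ i → E T v (tri3 w₁ w₂ w₃ i)
      pick {w₃} vw₃ = fin3 {A = λ i → E T v (tri3 w₁ w₂ w₃ i)} vw₁ vw₂ vw₃

      distinct₃ : ∀ {w₃} → w₃ ≢ w₁ → w₃ ≢ w₂ → ∀ i j → i ≢ j → tri3 w₁ w₂ w₃ i ≢ tri3 w₁ w₂ w₃ j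
      distinct₃ w₃≢w₁ w₃≢w₂ = λ
        { zero zero ne → ⊥-elim (ne refl) ; zero (suc zero) _ → w₁≢w₂ ; zero (suc (suc zero)) _ → ≢-sym w₃≢w₁
        ; (suc zero) zero _ → ≢-sym w₁≢w₂ ; (suc zero) (suc zero) ne → ⊥-elim (ne refl)
        ; (suc zero) (suc (suc zero)) _ → ≢-sym w₃≢w₂
        ; (suc (suc zero)) zero _ → w₃≢w₁ ; (suc (suc zero)) (suc zero) _ → w₃≢w₂
        ; (suc (suc zero)) (suc (suc zero)) ne → ⊥-elim (ne refl) }

      -- The arms are arbitrary, in particular those of another jewel's pyramid with another third
      -- edge. Each leg is exchanged in turn in the jewel's own pyramid, while the other one keeps
      -- its original rung.
      attachedTo : ∀ {M₁ M₂ q₁ q₂} → StripArm w₁ M₁ q₁ → StripArm w₂ M₂ q₂ →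
        ∀ {p} → ZJewel ζ a v w₁ w₂ p → AttachedTo p q₁ × AttachedTo p q₂
      attachedTo B₁ B₂ (p∉Z , w₃ , vw₃ , w₃≢w₁ , w₃≢w₂ , Z , J) =
        jewel-attached Z vw w-inj {zero} {suc zero} {suc (suc zero)} (λ ()) (λ ()) (λ ()) p∉Z J B₁ ,
        jewel-attached Z vw w-inj {suc zero} {zero} {suc (suc zero)} (λ ()) (λ ()) (λ ()) p∉Z J B₂
        where
        open Jewels tf pf ζ S rich ¬leaf
        vw = pick vw₃
        w-inj = distinct₃ w₃≢w₁ w₃≢w₂

    -- Three jewels at one seagull are all adjacent to b₁ and to the neighbour of b₂ on the second
    -- leg, so if stable they form a K₂,₃.
    noStableTriple : (f : Fin 3 → V G) → (∀ i j → f i ≡ f j → i ≡ j) → (∀ i j → ¬ E G (f i) (f j)) →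
      ∀ w₁ w₂ → E T v w₁ → E T v w₂ → w₁ ≢ w₂ → ZJewel ζ a v w₁ w₂ (f zero) →
      (∀ i → ∃[ x ] ∃[ x′ ] (SameEdge x x′ w₁ w₂ × ZJewel ζ a v x x′ (f i))) → ⊥
    noStableTriple f f-inj f-anti w₁ w₂ vw₁ vw₂ w₁≢w₂ (_ , w₃ , vw₃ , w₃≢w₁ , w₃≢w₂ , Z , _) jewels =
      thetaFromWalks tf (q₁ 0) (q₂ 1) (Meet.disj M (<⇒≤ B₁.long) B₂.long)
        (λ e → 1+n≢0 (proj₂ (Meet.only M (<⇒≤ B₁.long) B₂.long e)))
        (_≡ f zero) (_≡ f (suc zero)) (_≡ f (suc (suc zero)))
        (via zero) (via (suc zero)) (via (suc (suc zero)))
        (apart (λ ())) (apart (λ ())) (apart (λ ()))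
      where
      vw = pick vw₁ vw₂ w₁≢w₂ vw₃
      q₁ = leg Z zero
      q₂ = leg Z (suc zero)
      A₁ = stripArm Z vw zero
      A₂ = stripArm Z vw (suc zero)
      module B₁ = StripArm A₁
      module B₂ = StripArm A₂
      M = leg-meet Z vw {zero} {suc zero} (λ ())
      attached : ∀ i → AttachedTo (f i) q₁ × AttachedTo (f i) q₂
      attached i with jewels i
      ... | _ , _ , inj₁ (refl , refl) , J = attachedTo vw₁ vw₂ w₁≢w₂ A₁ A₂ J
      -- The same unordered seagull listed in the other order: the two legs change roles.
      ... | _ , _ , inj₂ (refl , refl) , J = swap (attachedTo vw₂ vw₁ (≢-sym w₁≢w₂) A₂ A₁ J)
      via : ∀ i → Walk G (EndsOr {G} (q₁ 0) (q₂ 1) (_≡ f i)) (q₁ 0) (q₂ 1)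
      via i = step (inj₁ refl) (E-sym G (proj₁ (proj₁ (attached i))))
        (step (inj₂ (inj₂ refl)) (proj₂ (proj₂ (attached i))) (stop (inj₂ (inj₁ refl))))
      apart : ∀ {i j} → i ≢ j → Apart G (_≡ f i) (_≡ f j)
      apart {i} {j} i≢j x y refl refl = (λ eq → i≢j (f-inj i j eq)) , f-anti i j

-- Either vertex `zero` has two neighbours, or a path from it to a non-neighbour has an interior
-- vertex. With smoothness this forces `δ` above two.
branching : ∀ T → Connected T → 3 ≤ n T → ∃[ v ] ¬ Leaf T v
branching T@record { n = suc (suc (suc m)) } conn (s≤s (s≤s (s≤s _))) = go (E? T zero (suc zero)) (E? T zero (suc (suc zero)))
  where
  middle : ∀ {u w} → u ≢ w → ¬ E T u w → ∃[ v ] ¬ Leaf T v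
  middle {u} {w} u≢w u≁w with conn u w
  ... | P , eqs , eqf with long-induced {T} {λ _ → ⊤} u≢w u≁w (P , eqs , eqf , λ _ → tt)
  middle u≢w u≁w | record { len = suc (suc l) ; vx = f ; inj = f-inj ; adjIff = A } , _ , _ | s≤s (s≤s _) =
    f (suc zero) , two-neighbours-notLeaf {T} (proj₂ (A (suc zero) zero) (inj₁ refl))
      (proj₂ (A (suc zero) (suc (suc zero))) (inj₂ refl)) (λ eq → Fin.0≢1+n (f-inj zero (suc (suc zero)) eq))
  go : Dec (E T zero (suc zero)) → Dec (E T zero (suc (suc zero))) → ∃[ v ] ¬ Leaf T v
  go (yes e) (yes e′) = zero , two-neighbours-notLeaf {T} {zero} e e′ (λ ())
  go (no ¬e) _ = middle (λ ()) ¬e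
  go _ (no ¬e) = middle (λ ()) ¬e

ramsey-bound : ∀ t δ r → RamseyProp t 3 r → Bound t δ ((δ C 2) * r)
ramsey-bound t δ r R G tf pf noClique a T (conn , _) (3≤n , smooth) (deg≤δ , _) ζ S rich v k f f-inj jewel
  with k <? (δ C 2) * r
... | yes k< = k<
... | no k≮ = ⊥-elim (manyJewels (δ C 2) refl)
  where
  ρ : V T → ℕ
  ρ = rank (adj T v)
  ρ< : ∀ w → E T v w → ρ w < δ
  ρ< w vw = <-≤-trans (rank<count (adj T v) w vw) (deg≤δ v)
  ρ-inj : ∀ {w w′} → E T v w → E T v w′ → ρ w ≡ ρ w′ → w ≡ w′
  ρ-inj = rank-injective (adj T v) _ _
  2<δ : 2 < δ
  2<δ with branching T conn 3≤n
  ... | u , ¬leaf with smooth u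
  ...   | inj₁ leaf = ⊥-elim (¬leaf leaf)
  ...   | inj₂ 2<deg = <-≤-trans 2<deg (deg≤δ u)
  code : Fin k → ℕ
  code i = let (w₁ , w₂ , _) = jewel i in pairCode (ρ w₁) (ρ w₂)
  code< : ∀ i → code i < δ C 2
  code< i with jewel i
  ... | w₁ , w₂ , vw₁ , vw₂ , w₁≢w₂ , _ = pairCode< (λ eq → w₁≢w₂ (ρ-inj vw₁ vw₂ eq)) (ρ< w₁ vw₁) (ρ< w₂ vw₂)
  code-inj : ∀ i j → code i ≡ code j →
    SameEdge (proj₁ (jewel i)) (proj₁ (proj₂ (jewel i))) (proj₁ (jewel j)) (proj₁ (proj₂ (jewel j)))
  code-inj i j eq with jewel i | jewel j
  ... | w₁ , w₂ , vw₁ , vw₂ , ne , _ | w₁′ , w₂′ , vw₁′ , vw₂′ , ne′ , _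
    with pairCode-injective (λ eq → ne (ρ-inj vw₁ vw₂ eq)) (λ eq → ne′ (ρ-inj vw₁′ vw₂′ eq)) eq
  ... | inj₁ (p , q) = inj₁ (ρ-inj vw₁ vw₁′ p , ρ-inj vw₂ vw₂′ q)
  ... | inj₂ (p , q) = inj₂ (ρ-inj vw₁ vw₂′ p , ρ-inj vw₂ vw₁′ q)
  noStable : ∀ b (g : Fin 3 → Fin k) → (∀ i j → g i ≡ g j → i ≡ j) → (∀ i → code (g i) ≡ b) →
             (∀ i j → ¬ E G (f (g i)) (f (g j))) → ⊥
  noStable b g g-inj same stable =
    let (w₁ , w₂ , vw₁ , vw₂ , ne , J) = jewel (g zero) in
    noStableTriple tf pf ζ S rich (two-neighbours-notLeaf {T} vw₁ vw₂ ne) (λ i → f (g i))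
      (λ i j eq → g-inj i j (f-inj _ _ eq)) stable w₁ w₂ vw₁ vw₂ ne J
      (λ i → _ , _ , code-inj (g i) (g zero) (trans (same i) (≡-sym (same zero))) ,
             proj₂ (proj₂ (proj₂ (proj₂ (proj₂ (jewel (g i)))))))
  manyJewels : ∀ N → N ≡ δ C 2 → ⊥
  -- A bound of zero would fail even without any jewel, so `δ C 2` has to be shown positive.
  manyJewels zero eq with ≤-trans (C2-step {0} {1} ≤-refl (<⇒≤ 2<δ)) (≤-reflexive (≡-sym eq))
  ... | ()
  manyJewels (suc N) eq
    with pigeonhole N r k code (λ i → subst (code i <_) (≡-sym eq) (code< i)) (subst (λ x → x * r ≤ k) (≡-sym eq) (≮⇒≥ k≮))
  ... | b , g , g-inj , same with R (induced G (λ i → f (g i))) ≤-refl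
  ...   | inj₁ clique = noClique (lift-clique {G} (λ i → f (g i)) (λ i j eq → g-inj i j (f-inj _ _ eq)) clique)
  ...   | inj₂ (h , h-inj , h-anti) =
    noStable b (λ i → g (h i)) (λ i j eq → h-inj i j (g-inj _ _ eq)) (λ i → same (h i)) h-anti

theorem5p4 : ∀ (t δ : ℕ) → 1 ≤ t → 1 ≤ δ →
    (Σ ℕ λ j → 1 ≤ j × Bound t δ j) ×
    (∀ r → IsRamsey t 3 r → Bound t δ ((δ C 2) * r))
-- The successor makes the bound positive at once, whatever value `ramsey` returns.
theorem5p4 t δ _ _ = (suc ((δ C 2) * r) , s≤s z≤n , bound) , λ r (R , _) → ramsey-bound t δ r R
  where
  r = proj₁ (ramsey t 3)
  bound : Bound t δ (suc ((δ C 2) * r))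
  bound G tf pf noClique a T tree smooth maxDeg ζ S rich v k f f-inj jewel =
    m<n⇒m<1+n (ramsey-bound t δ r (proj₂ (ramsey t 3)) G tf pf noClique a T tree smooth maxDeg ζ S rich v k f f-inj jewel)
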